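{- Let $r\ge 3$ and $e\in\{4,5,7,8\}$. For sufficiently large $n$ it holds that $f_r(n,e(r-2)+3,e)>n^{2-o(1)}$.
   Context: For integers $r,v,e$, an $r$-uniform hypergraph is called $\mathcal{G}_r(v,e)$-free if the union of any $e$ distinct edges has at least $v+1$ vertices. $f_r(n,v,e)$ denotes the maximum number of edges in a $\mathcal{G}_r(v,e)$-free $r$-uniform hypergraph on $n$ vertices. The $o(1)$ term tends to $0$ as $n\to\infty$. -}

module Defs where

open import Data.Nat using (ℕ; suc; _+_; _*_; _∸_; _≤_)
open import Data.List using (List; length)
open import Data.List.Relation.Unary.All using (All)
open import Data.List.Relation.Unary.Unique.Propositional using (Unique)
open import Data.List.Membership.Propositional using (_∈_)
open import Data.Fin.Subset using (Subset; ⋃; ∣_∣)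
open import Relation.Binary.PropositionalEquality using (_≡_)
open import Data.Product using (_×_)

record UniformHypergraph (r n : ℕ) : Set where
  field
    edges    : List (Subset n)
    distinct : Unique edges
    uniform  : All (λ E → ∣ E ∣ ≡ r) edges

open UniformHypergraph public

numEdges : ∀ {r n} → UniformHypergraph r n → ℕ
numEdges H = length (edges H)

GFree : ∀ {r n} → (v e : ℕ) → UniformHypergraph r n → Set
GFree {r} {n} v e H =
  (F : List (Subset n)) → Unique F → length F ≡ e → All (_∈ edges H) F →
  suc v ≤ ∣ ⋃ F ∣

{-# OPTIONS --safe #-}
-- An edge is a line x + t m, where x and m are k-tuples of polynomials in Y with small natural coefficients and all
-- m have the same Gram matrix of coefficients; its vertex of colour i is the value at t = i² + i Y. As k and the degree grow,
-- n vertices carry n^(2 - o(1)) lines. Evaluating Y at a rational number with large denominator loses no information and puts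
-- all m on a common sphere. A cycle of lines meeting in distinct colours gives a linear relation between their m whose
-- coefficients are differences of the numbers i² + i Y. For triangles and quadrilaterals Y can be chosen so that all
-- coefficients but one have the same sign, and strict convexity of the sphere then makes the lines coincide.
-- So two lines share at most one vertex and there are neither rainbow triangles nor rainbow quadrilaterals.
-- Replace every vertex by a star on the lines through it. The resulting graph on e lines is triangle-free, and the
-- colours exclude K₂,₄ and K₄,₄ minus a matching, so that it has at most 2e - 4 edges when e is 4, 5, 7 or 8;
-- hence e lines span at least e r - (2e - 4) vertices.
module Submission where

open import Data.Nat as ℕ using (ℕ; zero; suc; z≤n; s≤s; NonZero; >-nonZero)
import Data.Nat.Properties as ℕₚ
open import Data.Nat.Tactic.RingSolver using (solve-∀)
import Data.Integer as Int
import Data.Integer.Properties as ℤₚ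
open import Data.Integer.Tactic.RingSolver using () renaming (solve-∀ to solveℤ-∀)
open import Data.Bool using (Bool; true; false)
import Data.Bool.Properties as 𝔹
open import Data.Fin using (Fin; zero; suc; toℕ; fromℕ<; inject≤; combine; finToFun; funToFin)
import Data.Fin.Properties as 𝔽
open import Data.Fin.Subset using (Subset; inside; outside; ⋃; ∣_∣; ⁅_⁆; _∪_) renaming (_∈_ to _∈ₛ_)
open import Data.Fin.Subset.Properties
  using (x∈p∪q⁺; x∈p∪q⁻; x∈⁅x⁆; x∈⁅y⁆⇒x≡y; ∉⊥; ∣⊥∣≡0; ∣⁅x⁆∣≡1; x∈p⇒∣p-x∣<∣p∣; x∈p∧x≢y⇒x∈p-y)
open import Data.Vec using ([]; _∷_)
open import Data.List using (List; []; _∷_; _++_; length; filter; map; concat; allFin; cartesianProduct; lookup)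
open import Data.List.Properties using (length-++; length-map; length-tabulate)
open import Data.List.Membership.Propositional using (_∈_)
open import Data.List.Membership.Propositional.Properties
  using (∈-∃++; ∈-lookup; ∈-map⁻; ∈-map⁺; ∈-++⁻; ∈-++⁺ˡ; ∈-++⁺ʳ; ∈-allFin; ∈-filter⁻; ∈-filter⁺; ∈-cartesianProduct⁻)
open import Data.List.Relation.Unary.Any using (here; there)
open import Data.List.Relation.Unary.All as All using (All; []; _∷_)
import Data.List.Relation.Unary.All.Properties as All
open import Data.List.Relation.Unary.AllPairs as AllPairs using ([]; _∷_)
import Data.List.Relation.Unary.AllPairs.Properties as AllPairs
open import Data.List.Relation.Unary.Unique.Propositional using (Unique)
import Data.List.Relation.Unary.Unique.Propositional.Properties as Unique
open import Data.List.Relation.Binary.Permutation.Propositional as ↭ using (_↭_; ↭-sym; ↭-refl; ↭-trans; ↭⇒↭ₛ)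
open import Data.List.Relation.Binary.Permutation.Propositional.Properties using (shift; ↭-length)
import Data.List.Relation.Binary.Permutation.Setoid.Properties as Permₛ
open import Data.Product using (Σ; ∃; ∃₂; _×_; _,_; proj₁; proj₂)
open import Data.Sum using (_⊎_; inj₁; inj₂)
open import Data.Empty using (⊥; ⊥-elim)
open import Data.Unit using (tt)
open import Level using (0ℓ)
open import Relation.Binary.Definitions using (tri<; tri≈; tri>)
open import Relation.Binary.PropositionalEquality
  using (_≡_; _≢_; refl; sym; trans; cong; cong₂; subst; subst₂; ≢-sym; _≗_; setoid; module ≡-Reasoning)
open import Relation.Nullary using (Dec; does; yes; no; contradiction; ¬?)
open import Relation.Nullary.Decidable using (_×-dec_; _⊎-dec_; dec-true; dec-false; toWitness)
open import Relation.Unary using (Pred; Decidable)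
open import Function using (_∘_)
open import Algebra.Properties.AbelianGroup ℤₚ.+-0-abelianGroup using () renaming (∙-cancelˡ to +-cancelˡ)
open import Algebra.Properties.Semiring.Sum ℤₚ.+-*-semiring using (sum; sum-cong-≗; ∑-distrib-+; *-distribˡ-sum)
open import Algebra.Properties.Semiring.Sum ℕₚ.+-*-semiring using ()
  renaming (sum to sumℕ; sum-cong-≗ to sumℕ-cong; ∑-distrib-+ to sumℕ-+; sum-replicate-zero to sumℕ-zero)

-- Lines over ℤ[Y] and their intersections

-- Fixed numerical parameters would serve only those cycles round which they run monotonically, yet
-- four colours can be met in three essentially different cyclic orders. Keeping Y formal removes
-- this obstacle: a common point is an identity of polynomials, so each cycle may specialise Y anew.
-- A difference of parameters contains the factor i + j + Y, which at Y = 1/Q - u changes sign at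
-- the threshold i + j = u; a suitable u reorders the parameters as the cycle demands. A common Gram
-- matrix, unlike a common norm at one value of Y, yields a sphere for all these specialisations at
-- once. The price is small. Multiplication by Y costs one more coefficient, so about g^((d+1)k)
-- vertices face g^((2d+1)k) pairs (x, m) with digits below g. Fixing the Gram matrix divides the
-- latter by at most a constant times g^(2d²), an exponent free of k. A large d and then a larger k
-- push the exponent towards 2.

module IntegerLines where
  open Int using (ℤ; +_; -[1+_]; 0ℤ; 1ℤ; _+_; _*_; _-_; -_; _^_; _≤_; _<_)

  -- Strict convexity of the sphere with integer weights

  sum-nonNeg : ∀ {n} (f : Fin n → ℤ) → (∀ i → 0ℤ ≤ f i) → 0ℤ ≤ sum f
  sum-nonNeg {zero}  f f≥0 = ℤₚ.≤-refl
  sum-nonNeg {suc n} f f≥0 = ℤₚ.+-mono-≤ (f≥0 zero) (sum-nonNeg (f ∘ suc) (f≥0 ∘ suc))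

  nonNeg-sum-zero : ∀ {a b} → 0ℤ ≤ a → 0ℤ ≤ b → a + b ≡ 0ℤ → a ≡ 0ℤ × b ≡ 0ℤ
  nonNeg-sum-zero {+ zero} {+ zero} _ _ _ = refl , refl

  sum-zero : ∀ {n} (f : Fin n → ℤ) → (∀ i → 0ℤ ≤ f i) → sum f ≡ 0ℤ → ∀ i → f i ≡ 0ℤ
  sum-zero {suc n} f f≥0 eq i
    with f0≡0 , rest≡0 ← nonNeg-sum-zero (f≥0 zero) (sum-nonNeg (f ∘ suc) (f≥0 ∘ suc)) eq
    with i
  ... | zero  = f0≡0
  ... | suc i = sum-zero (f ∘ suc) (f≥0 ∘ suc) rest≡0 i

  square-nonNeg : ∀ a → 0ℤ ≤ a * a
  square-nonNeg (+ n)    = subst (0ℤ ≤_) (ℤₚ.pos-* n n) (Int.+≤+ z≤n)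
  square-nonNeg -[1+ n ] = Int.+≤+ z≤n

  weighted-nonNeg : ∀ {w} → 0ℤ < w → ∀ a → 0ℤ ≤ w * (a * a)
  weighted-nonNeg {w} w>0 a =
    subst (_≤ w * (a * a)) (ℤₚ.*-zeroʳ w)
      (ℤₚ.*-monoˡ-≤-nonNeg w {{Int.nonNegative (ℤₚ.<⇒≤ w>0)}} (square-nonNeg a))

  square-zero : ∀ {w} a b → 0ℤ < w → w * ((a - b) * (a - b)) ≡ 0ℤ → a ≡ b
  square-zero {w} a b w>0 eq with ℤₚ.i*j≡0⇒i≡0∨j≡0 w eq
  ... | inj₁ w≡0 = contradiction (sym w≡0) (ℤₚ.<⇒≢ w>0)
  ... | inj₂ sq with ℤₚ.i*j≡0⇒i≡0∨j≡0 (a - b) sq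
  ... | inj₁ e = ℤₚ.i-j≡0⇒i≡j a b e
  ... | inj₂ e = ℤₚ.i-j≡0⇒i≡j a b e

  private
    deviation : ∀ w₁ w₂ w₃ m₀ m₁ m₂ m₃ →
      w₁ * ((m₁ - m₀) * (m₁ - m₀)) + (w₂ * ((m₂ - m₀) * (m₂ - m₀)) + w₃ * ((m₃ - m₀) * (m₃ - m₀)))
      ≡ w₁ * (m₁ * m₁) + (w₂ * (m₂ * m₂) + (w₃ * (m₃ * m₃) + - (w₁ + w₂ + w₃) * (m₀ * m₀)))
        + (+ 2) * m₀ * ((w₁ + w₂ + w₃) * m₀ - (w₁ * m₁ + w₂ * m₂ + w₃ * m₃))
    deviation = solveℤ-∀

    cancel : ∀ w₁ w₂ w₃ s → w₁ * s + (w₂ * s + (w₃ * s + - (w₁ + w₂ + w₃) * s)) ≡ 0ℤ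
    cancel = solveℤ-∀

  -- A variance argument: by `deviation` and the balance relation, the weighted sum of squared
  -- distances from m₀ equals the weighted sum of the squared norms minus that of m₀, which is zero
  -- on a common sphere. Unnormalised weights keep everything in ℤ.
  sphere-strictlyConvex : ∀ {k} (m₀ m₁ m₂ m₃ : Fin k → ℤ) {w₁ w₂ w₃ s : ℤ} →
    0ℤ < w₁ → 0ℤ < w₂ → 0ℤ < w₃ →
    (∀ j → (w₁ + w₂ + w₃) * m₀ j ≡ w₁ * m₁ j + w₂ * m₂ j + w₃ * m₃ j) →
    sum (λ j → m₀ j * m₀ j) ≡ s → sum (λ j → m₁ j * m₁ j) ≡ s →
    sum (λ j → m₂ j * m₂ j) ≡ s → sum (λ j → m₃ j * m₃ j) ≡ s →
    ∀ j → m₁ j ≡ m₀ j × m₂ j ≡ m₀ j × m₃ j ≡ m₀ j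
  sphere-strictlyConvex m₀ m₁ m₂ m₃ {w₁} {w₂} {w₃} {s} w₁>0 w₂>0 w₃>0 bal e₀ e₁ e₂ e₃ j =
    let p₁ = weighted-nonNeg w₁>0 (m₁ j - m₀ j)
        p₂ = weighted-nonNeg w₂>0 (m₂ j - m₀ j)
        p₃ = weighted-nonNeg w₃>0 (m₃ j - m₀ j)
        z₁ , z₂₃ = nonNeg-sum-zero p₁ (ℤₚ.+-mono-≤ p₂ p₃) (sum-zero dev dev≥0 total j)
        z₂ , z₃ = nonNeg-sum-zero p₂ p₃ z₂₃
    in square-zero _ _ w₁>0 z₁ , square-zero _ _ w₂>0 z₂ , square-zero _ _ w₃>0 z₃
    where
    W = w₁ + w₂ + w₃
    dev dev′ : _ → ℤ
    dev j = w₁ * ((m₁ j - m₀ j) * (m₁ j - m₀ j)) + (w₂ * ((m₂ j - m₀ j) * (m₂ j - m₀ j)) + w₃ * ((m₃ j - m₀ j) * (m₃ j - m₀ j)))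
    dev′ j = w₁ * (m₁ j * m₁ j) + (w₂ * (m₂ j * m₂ j) + (w₃ * (m₃ j * m₃ j) + - W * (m₀ j * m₀ j)))
    dev≥0 : ∀ j → 0ℤ ≤ dev j
    dev≥0 j = ℤₚ.+-mono-≤ (weighted-nonNeg w₁>0 (m₁ j - m₀ j))
      (ℤₚ.+-mono-≤ (weighted-nonNeg w₂>0 (m₂ j - m₀ j)) (weighted-nonNeg w₃>0 (m₃ j - m₀ j)))
    dev≡ : ∀ j → dev j ≡ dev′ j
    dev≡ j = trans (deviation w₁ w₂ w₃ (m₀ j) (m₁ j) (m₂ j) (m₃ j))
      (trans (cong (λ u → dev′ j + (+ 2) * m₀ j * u) (ℤₚ.i≡j⇒i-j≡0 (bal j)))
        (trans (cong (λ u → dev′ j + u) (ℤₚ.*-zeroʳ ((+ 2) * m₀ j))) (ℤₚ.+-identityʳ (dev′ j))))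
    sq : ℤ → (_ → ℤ) → _ → ℤ
    sq w m j = w * (m j * m j)
    scale : ∀ w (m : _ → ℤ) → sum (λ j → m j * m j) ≡ s → sum (sq w m) ≡ w * s
    scale w m e = trans (sym (*-distribˡ-sum w (λ j → m j * m j))) (cong (w *_) e)
    total : sum dev ≡ 0ℤ
    total = trans (sum-cong-≗ dev≡)
      (trans (∑-distrib-+ (sq w₁ m₁) (λ j → sq w₂ m₂ j + (sq w₃ m₃ j + sq (- W) m₀ j))) (trans (cong₂ _+_ (scale w₁ m₁ e₁)
      (trans (∑-distrib-+ (sq w₂ m₂) (λ j → sq w₃ m₃ j + sq (- W) m₀ j)) (cong₂ _+_ (scale w₂ m₂ e₂)
      (trans (∑-distrib-+ (sq w₃ m₃) (sq (- W) m₀)) (cong₂ _+_ (scale w₃ m₃ e₃) (scale (- W) m₀ e₀))))))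
      (cancel w₁ w₂ w₃ s)))

  -- eval P Q f is Qⁿ⁻¹ times the value at P / Q of the polynomial with coefficients f, leading one first.
  eval : ℤ → ℤ → ∀ {n} → (Fin n → ℤ) → ℤ
  eval P Q {zero}  f = 0ℤ
  eval P Q {suc n} f = P ^ n * f zero + Q * eval P Q (f ∘ suc)

  module _ (P Q : ℤ) where
    private
      add-step : ∀ p q a b e f → p * (a + b) + q * (e + f) ≡ (p * a + q * e) + (p * b + q * f)
      add-step = solveℤ-∀
      scale-step : ∀ p q y a e → p * (a * y) + q * (e * y) ≡ (p * a + q * e) * y
      scale-step = solveℤ-∀

    eval-cong : ∀ {n} {f g : Fin n → ℤ} → f ≗ g → eval P Q f ≡ eval P Q g
    eval-cong {zero}  eq = refl
    eval-cong {suc n} eq = cong₂ (λ a e → P ^ n * a + Q * e) (eq zero) (eval-cong (eq ∘ suc))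

    eval-zero : ∀ {n} → eval P Q {n} (λ _ → 0ℤ) ≡ 0ℤ
    eval-zero {zero}  = refl
    eval-zero {suc n} = cong₂ _+_ (ℤₚ.*-zeroʳ (P ^ n)) (trans (cong (Q *_) (eval-zero {n})) (ℤₚ.*-zeroʳ Q))

    eval-+ : ∀ {n} (f g : Fin n → ℤ) → eval P Q (λ c → f c + g c) ≡ eval P Q f + eval P Q g
    eval-+ {zero}  f g = refl
    eval-+ {suc n} f g = trans (cong (λ e → P ^ n * (f zero + g zero) + Q * e) (eval-+ (f ∘ suc) (g ∘ suc)))
      (add-step (P ^ n) Q (f zero) (g zero) _ _)

    eval-* : ∀ {n} (f : Fin n → ℤ) y → eval P Q (λ c → f c * y) ≡ eval P Q f * y
    eval-* {zero}  f y = sym (ℤₚ.*-zeroˡ y)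
    eval-* {suc n} f y = trans (cong (λ e → P ^ n * (f zero * y) + Q * e) (eval-* (f ∘ suc) y))
      (scale-step (P ^ n) Q y (f zero) _)

    eval-sum : ∀ {k n} (F : Fin k → Fin n → ℤ) → eval P Q (λ c → sum (λ j → F j c)) ≡ sum (λ j → eval P Q (F j))
    eval-sum {zero}  {n} F = eval-zero {n}
    eval-sum {suc k} F = trans (eval-+ (F zero) (λ c → sum (λ j → F (suc j) c)))
      (cong (λ u → eval P Q (F zero) + u) (eval-sum (F ∘ suc)))

    -- The Gram matrix, with both of its indices evaluated, gives the squared norm. Hence equal Gram
    -- matrices mean a common sphere wherever Y is evaluated.
    normSq-eval : ∀ {k n} (F : Fin k → Fin n → ℤ) →
      sum (λ j → eval P Q (F j) * eval P Q (F j)) ≡ eval P Q (λ a → eval P Q (λ b → sum (λ j → F j b * F j a)))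
    normSq-eval F = trans
      (sum-cong-≗ (λ j → sym (trans (eval-cong (λ a → trans (eval-* (F j) (F j a)) (ℤₚ.*-comm (eval P Q (F j)) (F j a))))
                                     (eval-* (F j) (eval P Q (F j))))))
      (trans (sym (eval-sum (λ j a → eval P Q (λ b → F j b * F j a))))
        (eval-cong (λ a → sym (eval-sum (λ j b → F j b * F j a)))))

  -- Leading coefficients come first, so f itself is padded in front and its product with Y at the end.
  times1 timesY : ∀ {n} → (Fin n → ℕ) → Fin (suc n) → ℕ
  times1 f zero    = 0
  times1 f (suc c) = f c
  timesY {zero}  f c       = 0
  timesY {suc n} f zero    = f zero
  timesY {suc n} f (suc c) = timesY (f ∘ suc) c

  module _ (P Q : ℤ) where
    evalℕ : ∀ {n} → (Fin n → ℕ) → ℤ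
    evalℕ f = eval P Q (+_ ∘ f)

    evalℕ-times1 : ∀ {n} (f : Fin n → ℕ) → evalℕ (times1 f) ≡ Q * evalℕ f
    evalℕ-times1 {n} f = trans (cong (_+ Q * evalℕ f) (ℤₚ.*-zeroʳ (P ^ n))) (ℤₚ.+-identityˡ _)

    private
      shift-step : ∀ p q y a e → p * y * a + q * (p * e) ≡ p * (y * a + q * e)
      shift-step = solveℤ-∀

    evalℕ-timesY : ∀ {n} (f : Fin n → ℕ) → evalℕ (timesY f) ≡ P * evalℕ f
    evalℕ-timesY {zero}  f = trans (cong (λ e → 1ℤ * 0ℤ + e) (ℤₚ.*-zeroʳ Q)) (sym (ℤₚ.*-zeroʳ P))
    evalℕ-timesY {suc n} f = trans (cong (λ e → P ^ suc n * + f zero + Q * e) (evalℕ-timesY (f ∘ suc)))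
      (shift-step P Q (P ^ n) (+ f zero) (evalℕ (f ∘ suc)))

  private
    split-mod : ∀ p q w a b e f → p ≡ 1ℤ + q * w → p * a + q * e ≡ p * b + q * f →
      a - b ≡ q * (w * (b - a) + (f - e))
    split-mod p q w a b e f refl eq = trans (id₁ q w a b e f) (trans (cong (_+ q * (w * (b - a) + (f - e))) (ℤₚ.i≡j⇒i-j≡0 eq)) (ℤₚ.+-identityˡ _))
      where
      id₁ : ∀ q w a b e f → a - b ≡ (((1ℤ + q * w) * a + q * e) - ((1ℤ + q * w) * b + q * f)) + q * (w * (b - a) + (f - e))
      id₁ = solveℤ-∀

    power-mod : ∀ z q n → ∃ λ w → (1ℤ + z * q) ^ n ≡ 1ℤ + q * w
    power-mod z q zero    = 0ℤ , sym (trans (cong (λ u → 1ℤ + u) (ℤₚ.*-zeroʳ q)) refl)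
    power-mod z q (suc n) with w , eq ← power-mod z q n =
      z + w + z * q * w , trans (cong ((1ℤ + z * q) *_) eq) (id₂ z q w)
      where
      id₂ : ∀ z q w → (1ℤ + z * q) * (1ℤ + q * w) ≡ 1ℤ + q * (z + w + z * q * w)
      id₂ = solveℤ-∀

  -- A multiple of g whose absolute value is below g is zero.
  digit-unique : ∀ {a b g} {u : ℤ} → a ℕ.< g → b ℕ.< g → + a - + b ≡ + g * u → a ≡ b
  digit-unique {a} {b} {g} {u} a<g b<g eq = ℤₚ.+-injective (ℤₚ.i-j≡0⇒i≡j (+ a) (+ b) (ℤₚ.∣i∣≡0⇒i≡0 diff≡0))
    where
    g*∣u∣ : Int.∣ + a - + b ∣ ≡ g ℕ.* Int.∣ u ∣
    g*∣u∣ = trans (cong Int.∣_∣ eq) (ℤₚ.abs-* (+ g) u)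
    bound : Int.∣ + a - + b ∣ ℕ.< g
    bound = subst (ℕ._< g) (cong Int.∣_∣ (sym (ℤₚ.m-n≡m⊖n a b)))
      (ℕₚ.≤-<-trans (ℤₚ.∣m⊝n∣≤m⊔n a b) (ℕₚ.⊔-pres-<m a<g b<g))
    diff≡0 : Int.∣ + a - + b ∣ ≡ 0
    diff≡0 with Int.∣ u ∣ | g*∣u∣
    ... | zero  | e = trans e (ℕₚ.*-zeroʳ g)
    ... | suc v | e = contradiction (subst (ℕ._< g) (trans e (ℕₚ.*-suc g v)) bound) (ℕₚ.m+n≮m g _)

  -- Since P ≡ 1 modulo Q, the leading digit is the value modulo Q.
  evalℕ-injective : ∀ z g .{{_ : ℕ.NonZero g}} {n} (f h : Fin n → ℕ) → (∀ c → f c ℕ.< g) → (∀ c → h c ℕ.< g) →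
    evalℕ (1ℤ + z * + g) (+ g) f ≡ evalℕ (1ℤ + z * + g) (+ g) h → f ≗ h
  evalℕ-injective z g {suc n} f h f< h< eq = go
    where
    P = 1ℤ + z * + g
    F = evalℕ P (+ g) (f ∘ suc)
    H = evalℕ P (+ g) (h ∘ suc)
    head≡ : f zero ≡ h zero
    head≡ with w , pw ← power-mod z (+ g) n =
      digit-unique (f< zero) (h< zero) (split-mod (P ^ n) (+ g) w (+ f zero) (+ h zero) F H pw eq)
    tail≡ : F ≡ H
    tail≡ = ℤₚ.*-cancelˡ-≡ (+ g) F H {{Int.≢-nonZero λ e → ℕ.≢-nonZero⁻¹ g (ℤₚ.+-injective e)}}
      (+-cancelˡ (P ^ n * + f zero) (+ g * F) (+ g * H) (trans eq (cong (λ a → P ^ n * + a + + g * H) (sym head≡))))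
    go : f ≗ h
    go zero    = head≡
    go (suc c) = evalℕ-injective z g (f ∘ suc) (h ∘ suc) (f< ∘ suc) (h< ∘ suc) tail≡ c

  record Line (k d : ℕ) : Set where
    constructor line
    field
      intercept : Fin k → Fin (suc d) → ℕ
      slope     : Fin k → Fin d → ℕ
  open Line

  -- The value of x + t m at t = i² + i Y. The differences of i² + i Y are (i - j) (i + j + Y), so their signs depend on where Y is evaluated.
  point : ∀ {k d} → ℕ → Line k d → Fin k → Fin (suc d) → ℕ
  point i L j c = intercept L j c ℕ.+ (i ℕ.* i ℕ.* times1 (slope L j) c ℕ.+ i ℕ.* timesY (slope L j) c)

  record Meet {k d} (i : ℕ) (A B : Line k d) : Set where
    constructor meet
    field point≡ : ∀ j c → point i A j c ≡ point i B j c
  open Meet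

  Meet-refl : ∀ {k d i} {A : Line k d} → Meet i A A
  Meet-refl = meet λ j c → refl

  Meet-sym : ∀ {k d i} {A B : Line k d} → Meet i A B → Meet i B A
  Meet-sym m = meet λ j c → sym (point≡ m j c)

  record Parallel {k d} (A B : Line k d) : Set where
    constructor parallel
    field slope≡ : ∀ j c → slope A j c ≡ slope B j c
  open Parallel

  Parallel-sym : ∀ {k d} {A B : Line k d} → Parallel A B → Parallel B A
  Parallel-sym s = parallel λ j c → sym (slope≡ s j c)

  Parallel-trans : ∀ {k d} {A B C : Line k d} → Parallel A B → Parallel B C → Parallel A C
  Parallel-trans s t = parallel λ j c → trans (slope≡ s j c) (slope≡ t j c)

  gram : ∀ {k d} → (Fin k → Fin d → ℕ) → Fin d → Fin d → ℕ
  gram m a b = sumℕ (λ j → m j b ℕ.* m j a)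

  record Admissible {k d} (g : ℕ) (G : Fin d → Fin d → ℕ) (L : Line k d) : Set where
    constructor admissible
    field
      digits< : ∀ j c → slope L j c ℕ.< g
      gram≡   : ∀ a b → gram (slope L) a b ≡ G a b
  open Admissible

  pos-sumℕ : ∀ {n} (f : Fin n → ℕ) → + sumℕ f ≡ sum (+_ ∘ f)
  pos-sumℕ {zero}  f = refl
  pos-sumℕ {suc n} f = trans (ℤₚ.pos-+ (f zero) _) (cong (λ u → + f zero + u) (pos-sumℕ (f ∘ suc)))

  *-pos : ∀ {x y} → 0ℤ < x → 0ℤ < y → 0ℤ < x * y
  *-pos {+ suc a} {+ suc b} _ _ = Int.+<+ (s≤s z≤n)
  *-pos {+ zero}  (Int.+<+ ())
  *-pos {+ suc a} {+ zero} _ (Int.+<+ ())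

  -- Specialising Y to 1/Q - u

  module _ (u Q : ℕ) where

    private
      -- Y becomes `numer` / Q = 1/Q - u. Then i + j + Y is positive exactly when u ≤ i + j, and
      -- `numer` ≡ 1 modulo Q keeps digits below Q recoverable.
      numer : ℤ
      numer = 1ℤ + (- + u) * + Q

    -- The parameter i² + i Y at this Y, times Q to clear the denominator.
    coefficient : ℕ → ℤ
    coefficient i = + i * + i * + Q + + i * numer

    private
      inc-id : ∀ i j u q → (j * j * q + j * (1ℤ + (- u) * q)) - (i * i * q + i * (1ℤ + (- u) * q))
        ≡ (j - i) * ((i + j - u) * q + 1ℤ)
      inc-id = solveℤ-∀
      dec-id : ∀ i j u q → (j * j * q + j * (1ℤ + (- u) * q)) - (i * i * q + i * (1ℤ + (- u) * q))
        ≡ (i - j) * ((u - (i + j)) * q - 1ℤ)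
      dec-id = solveℤ-∀
      back : ∀ a b → a + b - a ≡ b
      back = solveℤ-∀
      diff : ∀ {a b} c → a ℕ.+ c ≡ b → + b - + a ≡ + c
      diff {a} c refl = trans (cong (_- + a) (ℤₚ.pos-+ a c)) (back (+ a) (+ c))
      linear-id : ∀ x i q p e → x + (i * i * (q * e) + i * (p * e)) ≡ x + (i * i * q + i * p) * e
      linear-id = solveℤ-∀

    coefficient-increasing : ∀ {i j} → i ℕ.< j → u ℕ.≤ i ℕ.+ j → 0ℤ < coefficient j - coefficient i
    coefficient-increasing {i} {j} i<j u≤
      with a , ea ← ℕₚ.m≤n⇒∃[o]m+o≡n i<j | s , es ← ℕₚ.m≤n⇒∃[o]m+o≡n u≤ =
      subst (0ℤ <_) (sym (inc-id (+ i) (+ j) (+ u) (+ Q)))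
        (*-pos (subst (0ℤ <_) (sym (diff (suc a) (trans (ℕₚ.+-suc i a) ea))) (Int.+<+ (s≤s z≤n)))
               (subst (λ v → 0ℤ < v * + Q + 1ℤ) (trans (sym (diff s es)) (cong (_- + u) (ℤₚ.pos-+ i j)))
                 (subst (λ v → 0ℤ < v + 1ℤ) (ℤₚ.pos-* s Q) (Int.+<+ (ℕₚ.m≤n+m 1 (s ℕ.* Q))))))

    coefficient-decreasing : ∀ {i j} → 2 ℕ.≤ Q → j ℕ.< i → i ℕ.+ j ℕ.< u → 0ℤ < coefficient j - coefficient i
    coefficient-decreasing {i} {j} 2≤Q j<i <u
      with a , ea ← ℕₚ.m≤n⇒∃[o]m+o≡n j<i | s , es ← ℕₚ.m≤n⇒∃[o]m+o≡n <u =
      subst (0ℤ <_) (sym (dec-id (+ i) (+ j) (+ u) (+ Q)))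
        (*-pos (subst (0ℤ <_) (sym (diff (suc a) (trans (ℕₚ.+-suc j a) ea))) (Int.+<+ (s≤s z≤n)))
               (subst (λ v → 0ℤ < v * + Q - 1ℤ)
                 (trans (sym (diff (suc s) (trans (ℕₚ.+-suc (i ℕ.+ j) s) es))) (cong (λ v → + u - v) (ℤₚ.pos-+ i j)))
                 (subst (λ v → 0ℤ < v - 1ℤ) (ℤₚ.pos-* (suc s) Q) (big (Q) 2≤Q))))
      where
      -- At i + j = u - 1 the second factor is Q - 1, which would vanish for Q = 1.
      big : ∀ q → 2 ℕ.≤ q → 0ℤ < + (q ℕ.+ s ℕ.* q) - 1ℤ
      big (suc (suc q)) _ = Int.+<+ (s≤s z≤n)
      big (suc zero) (s≤s ())

    module _ {k d : ℕ} where

      slopeValue : Line k d → Fin k → ℤ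
      slopeValue L j = evalℕ numer (+ Q) (slope L j)

      interceptValue : Line k d → Fin k → ℤ
      interceptValue L j = evalℕ numer (+ Q) (intercept L j)

      -- Padding by `times1` contributes a factor Q and by `timesY` a factor `numer`; together they
      -- make up `coefficient`.
      point-value : ∀ i L j → evalℕ numer (+ Q) (point i L j) ≡ interceptValue L j + coefficient i * slopeValue L j
      point-value i L j = begin
        evalℕ numer (+ Q) (point i L j)
          ≡⟨ eval-cong numer (+ Q) {f = +_ ∘ point i L j} split ⟩
        eval numer (+ Q) (λ c → + x c + (+ t c * i² + + y c * + i))
          ≡⟨ eval-+ numer (+ Q) (+_ ∘ x) (λ c → + t c * i² + + y c * + i) ⟩
        interceptValue L j + eval numer (+ Q) (λ c → + t c * i² + + y c * + i)
          ≡⟨ cong (λ v → interceptValue L j + v) (eval-+ numer (+ Q) (λ c → + t c * i²) (λ c → + y c * + i)) ⟩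
        interceptValue L j + (eval numer (+ Q) (λ c → + t c * i²) + eval numer (+ Q) (λ c → + y c * + i))
          ≡⟨ cong (λ v → interceptValue L j + v) (cong₂ _+_
               (trans (eval-* numer (+ Q) (+_ ∘ t) i²) (trans (ℤₚ.*-comm (evalℕ numer (+ Q) t) i²) (cong (λ v → i² * v) (evalℕ-times1 numer (+ Q) (slope L j)))))
               (trans (eval-* numer (+ Q) (+_ ∘ y) (+ i)) (trans (ℤₚ.*-comm (evalℕ numer (+ Q) y) (+ i)) (cong (λ v → + i * v) (evalℕ-timesY numer (+ Q) (slope L j)))))) ⟩
        interceptValue L j + (i² * (+ Q * slopeValue L j) + + i * (numer * slopeValue L j))
          ≡⟨ linear-id (interceptValue L j) (+ i) (+ Q) numer (slopeValue L j) ⟩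
        interceptValue L j + coefficient i * slopeValue L j ∎
        where
        open ≡-Reasoning
        i² = + i * + i
        x = intercept L j
        t = times1 (slope L j)
        y = timesY (slope L j)
        split : ∀ c → + point i L j c ≡ + x c + (+ t c * i² + + y c * + i)
        split c = trans (ℤₚ.pos-+ (x c) _) (cong (λ v → + x c + v) (trans (ℤₚ.pos-+ (i ℕ.* i ℕ.* t c) _) (cong₂ _+_
          (trans (ℤₚ.pos-* (i ℕ.* i) (t c)) (trans (cong (_* + t c) (ℤₚ.pos-* i i)) (ℤₚ.*-comm i² (+ t c))))
          (trans (ℤₚ.pos-* i (y c)) (ℤₚ.*-comm (+ i) (+ y c))))))

      meet-value : ∀ {i A B} → Meet i A B → ∀ j →
        interceptValue A j + coefficient i * slopeValue A j ≡ interceptValue B j + coefficient i * slopeValue B j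
      meet-value {i} {A} {B} m j = trans (sym (point-value i A j))
        (trans (eval-cong numer (+ Q) {f = +_ ∘ point i A j} (λ c → cong +_ (point≡ m j c))) (point-value i B j))

      private
        -- Adding the four meeting relations round the cycle cancels the intercepts and leaves only
        -- consecutive differences of parameters as weights.
        balance : ∀ {p q r t a b c e x y v w} →
          a + p * x ≡ b + p * y → b + q * y ≡ c + q * v → c + r * v ≡ e + r * w → e + t * w ≡ a + t * x →
          ((q - p) + (r - q) + (t - r)) * x ≡ (q - p) * y + (r - q) * v + (t - r) * w
        balance {p} {q} {r} {t} {a} {b} {c} {e} {x} {y} {v} {w} h₁ h₂ h₃ h₄ = ℤₚ.i-j≡0⇒i≡j _ _
          (trans (id₁ a b c e x y v w p q r t)
            (cong -_ (cong₂ _+_ (cong₂ _+_ (ℤₚ.i≡j⇒i-j≡0 h₁) (ℤₚ.i≡j⇒i-j≡0 h₂)) (cong₂ _+_ (ℤₚ.i≡j⇒i-j≡0 h₃) (ℤₚ.i≡j⇒i-j≡0 h₄)))))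
          where
          id₁ : ∀ a b c e x y v w p q r t →
            ((q - p) + (r - q) + (t - r)) * x - ((q - p) * y + (r - q) * v + (t - r) * w)
            ≡ - ((((a + p * x) - (b + p * y)) + ((b + q * y) - (c + q * v)))
               + (((c + r * v) - (e + r * w)) + ((e + t * w) - (a + t * x))))
          id₁ = solveℤ-∀

      normSq : ∀ {g G L} → Admissible g G L →
        sum (λ j → slopeValue L j * slopeValue L j) ≡ eval numer (+ Q) (λ a → eval numer (+ Q) (λ b → + G a b))
      normSq {L = L} ad = trans (normSq-eval numer (+ Q) (λ j c → + slope L j c))
        (eval-cong numer (+ Q) (λ a → eval-cong numer (+ Q) (λ b →
          trans (trans (sum-cong-≗ (λ j → sym (ℤₚ.pos-* (slope L j b) (slope L j a)))) (sym (pos-sumℕ (λ j → slope L j b ℕ.* slope L j a))))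
                (cong +_ (gram≡ ad a b)))))

      -- When the parameters increase along p, q, r, t, the cycle relation exhibits the slope of A
      -- as a convex combination with positive weights of the other three slopes, all on one sphere.
      cyclic-monotone-parallel : ∀ {G p q r t} {A B C D : Line k d} → 2 ℕ.≤ Q →
        Admissible Q G A → Admissible Q G B → Admissible Q G C → Admissible Q G D →
        0ℤ < coefficient q - coefficient p → 0ℤ < coefficient r - coefficient q → 0ℤ < coefficient t - coefficient r →
        Meet p A B → Meet q B C → Meet r C D → Meet t D A →
        Parallel A B × Parallel B C × Parallel C D
      cyclic-monotone-parallel {p = p} {q} {r} {t} {A} {B} {C} {D} 2≤Q a b c e pq qr rt mp mq mr mt =
        Parallel-sym B∥A , Parallel-trans B∥A (Parallel-sym C∥A) , Parallel-trans C∥A (Parallel-sym D∥A)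
        where
        conv : ∀ j → slopeValue B j ≡ slopeValue A j × slopeValue C j ≡ slopeValue A j × slopeValue D j ≡ slopeValue A j
        conv = sphere-strictlyConvex (slopeValue A) (slopeValue B) (slopeValue C) (slopeValue D) pq qr rt
          (λ j → balance {p = coefficient p} {coefficient q} {coefficient r} {coefficient t}
               {interceptValue A j} {interceptValue B j} {interceptValue C j} {interceptValue D j} (meet-value mp j) (meet-value mq j) (meet-value mr j) (meet-value mt j))
          (normSq a) (normSq b) (normSq c) (normSq e)
        instance
          Q≢0 : ℕ.NonZero Q
          Q≢0 = ℕ.>-nonZero (ℕₚ.<-trans (s≤s z≤n) 2≤Q)
        -- Equality at this single Y lifts to equality of coefficients, because the digits lie below
        -- Q.
        lift : ∀ {G L L′} → Admissible Q G L → Admissible Q G L′ → (∀ j → slopeValue L j ≡ slopeValue L′ j) → Parallel L L′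
        lift l l′ eq = parallel λ j → evalℕ-injective (- + u) Q _ _ (digits< l j) (digits< l′ j) (eq j)
        B∥A = lift b a (proj₁ ∘ conv)
        C∥A = lift c a (proj₁ ∘ proj₂ ∘ conv)
        D∥A = lift e a (proj₂ ∘ proj₂ ∘ conv)

  -- Choosing Y for each cyclic order of four colours

  module _ {k d g : ℕ} {G : Fin d → Fin d → ℕ} (2≤g : 2 ℕ.≤ g) where

    private
      Ad : Line k d → Set
      Ad = Admissible g G

      AllParallel : (A B C D : Line k d) → Set
      AllParallel A B C D = Parallel A B × Parallel B C × Parallel C D

      rotate : ∀ {A B C D : Line k d} → AllParallel A B C D → AllParallel D A B C
      rotate (ab , bc , cd) = Parallel-sym (Parallel-trans ab (Parallel-trans bc cd)) , ab , bc

      reverse : ∀ {A B C D : Line k d} → AllParallel A B C D → AllParallel D C B A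
      reverse (ab , bc , cd) = Parallel-sym cd , Parallel-sym bc , Parallel-sym ab

    private
      -- With t largest and p < r, only the place of q varies. For p < q < r the choice u = 0
      -- already gives increasing parameters. Otherwise u = p + q + 1 reverses the pair p, q but
      -- neither the pair q, r nor any pair with t: the parameters increase along p, q, r, t if q <
      -- p, and along r, q, p, t if r < q.
      sorted-parallel : ∀ {p q r t} {A B C D : Line k d} → Ad A → Ad B → Ad C → Ad D →
        q ≢ p → q ≢ r → p ℕ.< r → q ℕ.< t → r ℕ.< t →
        Meet p A B → Meet q B C → Meet r C D → Meet t D A → AllParallel A B C D
      sorted-parallel {p} {q} {r} {t} a b c e q≢p q≢r p<r q<t r<t mp mq mr mt with ℕₚ.<-cmp q p | ℕₚ.<-cmp q r
      ... | tri≈ _ q≡p _ | _ = contradiction q≡p q≢p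
      ... | tri> _ _ _ | tri≈ _ q≡r _ = contradiction q≡r q≢r
      ... | tri< _ _ _ | tri≈ _ q≡r _ = contradiction q≡r q≢r
      ... | tri< q<p _ _ | tri> _ _ r<q = contradiction (ℕₚ.<-trans q<p (ℕₚ.<-trans p<r r<q)) (ℕₚ.<-irrefl refl)
      ... | tri> _ _ p<q | tri< q<r _ _ = cyclic-monotone-parallel 0 g 2≤g a b c e
        (coefficient-increasing 0 g p<q z≤n) (coefficient-increasing 0 g q<r z≤n) (coefficient-increasing 0 g r<t z≤n) mp mq mr mt
      ... | tri< q<p _ _ | tri< q<r _ _ = cyclic-monotone-parallel u g 2≤g a b c e
        (coefficient-decreasing u g 2≤g q<p ℕₚ.≤-refl)
        (coefficient-increasing u g q<r (subst (ℕ._< q ℕ.+ r) (ℕₚ.+-comm q p) (ℕₚ.+-monoʳ-< q p<r)))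
        (coefficient-increasing u g r<t (ℕₚ.+-mono-<-≤ p<r (ℕₚ.<⇒≤ q<t))) mp mq mr mt
        where u = suc (p ℕ.+ q)
      ... | tri> _ _ p<q | tri> _ _ r<q = reverse (cyclic-monotone-parallel u g 2≤g e c b a
        (coefficient-increasing u g r<q (ℕₚ.+-monoˡ-< q p<r))
        (coefficient-decreasing u g 2≤g p<q (subst (ℕ._< u) (ℕₚ.+-comm p q) ℕₚ.≤-refl))
        (coefficient-increasing u g (ℕₚ.<-trans p<r r<t) (ℕₚ.+-monoʳ-< p q<t))
        (Meet-sym mr) (Meet-sym mq) (Meet-sym mp) (Meet-sym mt))
        where u = suc (p ℕ.+ q)

      max-parallel : ∀ {p q r t} {A B C D : Line k d} → Ad A → Ad B → Ad C → Ad D →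
        q ≢ p → q ≢ r → p ≢ r → p ℕ.< t → q ℕ.< t → r ℕ.< t →
        Meet p A B → Meet q B C → Meet r C D → Meet t D A → AllParallel A B C D
      max-parallel {p} {q} {r} a b c e q≢p q≢r p≢r p<t q<t r<t mp mq mr mt with ℕₚ.<-cmp p r
      ... | tri< p<r _ _ = sorted-parallel a b c e q≢p q≢r p<r q<t r<t mp mq mr mt
      ... | tri≈ _ p≡r _ = contradiction p≡r p≢r
      ... | tri> _ _ r<p = reverse (sorted-parallel e c b a q≢r q≢p r<p q<t p<t
                                      (Meet-sym mr) (Meet-sym mq) (Meet-sym mp) (Meet-sym mt))

    -- Rotating the cycle brings its largest colour to the last place.
    rainbow-quadrilateral-parallel : ∀ {p q r t} {A B C D : Line k d} → Ad A → Ad B → Ad C → Ad D →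
      p ≢ q → p ≢ r → p ≢ t → q ≢ r → q ≢ t → r ≢ t →
      Meet p A B → Meet q B C → Meet r C D → Meet t D A → AllParallel A B C D
    rainbow-quadrilateral-parallel {p} {q} {r} {t} a b c e p≢q p≢r p≢t q≢r q≢t r≢t mp mq mr mt
      with ℕₚ.<-cmp p q | ℕₚ.<-cmp r t
    ... | tri≈ _ p≡q _ | _ = contradiction p≡q p≢q
    ... | _ | tri≈ _ r≡t _ = contradiction r≡t r≢t
    ... | tri< p<q _ _ | tri< r<t _ _ with ℕₚ.<-cmp q t
    ...   | tri≈ _ q≡t _ = contradiction q≡t q≢t
    ...   | tri< q<t _ _ = max-parallel a b c e (≢-sym p≢q) q≢r p≢r (ℕₚ.<-trans p<q q<t) q<t r<t mp mq mr mt
    ...   | tri> _ _ t<q = rotate (rotate (max-parallel c e a b (≢-sym r≢t) (≢-sym p≢t) (≢-sym p≢r) (ℕₚ.<-trans r<t t<q) t<q p<q mr mt mp mq))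
    rainbow-quadrilateral-parallel {p} {q} {r} {t} a b c e p≢q p≢r p≢t q≢r q≢t r≢t mp mq mr mt
        | tri< p<q _ _ | tri> _ _ t<r with ℕₚ.<-cmp q r
    ...   | tri≈ _ q≡r _ = contradiction q≡r q≢r
    ...   | tri< q<r _ _ = rotate (rotate (rotate (max-parallel e a b c p≢t p≢q (≢-sym q≢t) t<r (ℕₚ.<-trans p<q q<r) q<r mt mp mq mr)))
    ...   | tri> _ _ r<q = rotate (rotate (max-parallel c e a b (≢-sym r≢t) (≢-sym p≢t) (≢-sym p≢r) r<q (ℕₚ.<-trans t<r r<q) p<q mr mt mp mq))
    rainbow-quadrilateral-parallel {p} {q} {r} {t} a b c e p≢q p≢r p≢t q≢r q≢t r≢t mp mq mr mt
        | tri> _ _ q<p | tri< r<t _ _ with ℕₚ.<-cmp p t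
    ...   | tri≈ _ p≡t _ = contradiction p≡t p≢t
    ...   | tri< p<t _ _ = max-parallel a b c e (≢-sym p≢q) q≢r p≢r p<t (ℕₚ.<-trans q<p p<t) r<t mp mq mr mt
    ...   | tri> _ _ t<p = rotate (max-parallel b c e a (≢-sym q≢r) r≢t q≢t q<p (ℕₚ.<-trans r<t t<p) t<p mq mr mt mp)
    rainbow-quadrilateral-parallel {p} {q} {r} {t} a b c e p≢q p≢r p≢t q≢r q≢t r≢t mp mq mr mt
        | tri> _ _ q<p | tri> _ _ t<r with ℕₚ.<-cmp p r
    ...   | tri≈ _ p≡r _ = contradiction p≡r p≢r
    ...   | tri< p<r _ _ = rotate (rotate (rotate (max-parallel e a b c p≢t p≢q (≢-sym q≢t) t<r p<r (ℕₚ.<-trans q<p p<r) mt mp mq mr)))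
    ...   | tri> _ _ r<p = rotate (max-parallel b c e a (≢-sym q≢r) r≢t q≢t q<p r<p (ℕₚ.<-trans t<r r<p) mq mr mt mp)

open IntegerLines
open import Defs
open import Data.Nat using (ℕ; _+_; _*_; _∸_; _^_; _≤_; _<_; _≤?_; _<?_)
open import Data.Nat.Properties

-- Edge-coloured graphs without rainbow quadrilaterals

Unique-resp-↭ : ∀ {A : Set} {xs ys : List A} → xs ↭ ys → Unique xs → Unique ys
Unique-resp-↭ {A} p = Permₛ.Unique-resp-↭ (setoid A) (↭⇒↭ₛ p)

lookup-injective : ∀ {A : Set} {xs : List A} → Unique xs → ∀ i j → i ≢ j → lookup xs i ≢ lookup xs j
lookup-injective (x∉xs ∷ xs!) zero    zero    i≢j = contradiction refl i≢j
lookup-injective (x∉xs ∷ xs!) zero    (suc j) i≢j = All.lookup x∉xs (∈-lookup j)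
lookup-injective (x∉xs ∷ xs!) (suc i) zero    i≢j = ≢-sym (All.lookup x∉xs (∈-lookup i))
lookup-injective (x∉xs ∷ xs!) (suc i) (suc j) i≢j = lookup-injective xs! i j (i≢j ∘ cong suc)

abstract
  avoid₃ : (x y z : Fin 4) → ∃ λ j → j ≢ x × j ≢ y × j ≢ z
  avoid₃ = toWitness {a? = 𝔽.all? λ x → 𝔽.all? λ y → 𝔽.all? λ z → 𝔽.any? λ j →
    ¬? (j 𝔽.≟ x) ×-dec ¬? (j 𝔽.≟ y) ×-dec ¬? (j 𝔽.≟ z)} tt

avoid₂ : (x y : Fin 4) → ∃₂ λ j k → j ≢ k × j ≢ x × j ≢ y × k ≢ x × k ≢ y
avoid₂ x y with j , j≢x , j≢y , _ ← avoid₃ x y y with k , k≢x , k≢y , k≢j ← avoid₃ x y j =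
  j , k , ≢-sym k≢j , j≢x , j≢y , k≢x , k≢y

-- The colours c, c′ of two edges at one vertex and d, d′ of the edges at another one with the same two endpoints.
Compatible : {C : Set} → (c d c′ d′ : C) → Set
Compatible c d c′ d′ = c ≢ c′ × d ≢ d′ × c ≢ d × c′ ≢ d′ × (c ≡ d′ ⊎ d ≡ c′)

module _ {C : Set} where

  -- Read cᵢ = dⱼ as an arc from i to j. Distinct c's and distinct d's allow each index one arc out
  -- and one arc in, so at most four arcs, while the six pairs need one each.
  no-four-compatible : ∀ {c₁ d₁ c₂ d₂ c₃ d₃ c₄ d₄ : C} →
    Compatible c₁ d₁ c₂ d₂ → Compatible c₁ d₁ c₃ d₃ → Compatible c₁ d₁ c₄ d₄ →
    Compatible c₂ d₂ c₃ d₃ → Compatible c₂ d₂ c₄ d₄ → Compatible c₃ d₃ c₄ d₄ → ⊥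
  no-four-compatible (_ , _ , _ , _ , inj₁ p) (_ , _ , _ , _ , inj₁ q) _ (_ , d₂≢d₃ , _) _ _ = d₂≢d₃ (trans (sym p) q)
  no-four-compatible (_ , _ , _ , _ , inj₂ p) (_ , _ , _ , _ , inj₂ q) _ (c₂≢c₃ , _) _ _ = c₂≢c₃ (trans (sym p) q)
  no-four-compatible (_ , _ , _ , _ , inj₁ p) (_ , _ , _ , _ , inj₂ q) (_ , _ , _ , _ , inj₁ s) _ (_ , d₂≢d₄ , _) _ = d₂≢d₄ (trans (sym p) s)
  no-four-compatible (_ , _ , _ , _ , inj₁ p) (_ , _ , _ , _ , inj₂ q) (_ , _ , _ , _ , inj₂ s) _ _ (c₃≢c₄ , _) = c₃≢c₄ (trans (sym q) s)
  no-four-compatible (_ , _ , _ , _ , inj₂ p) (_ , _ , _ , _ , inj₁ q) (_ , _ , _ , _ , inj₁ s) _ _ (_ , d₃≢d₄ , _) = d₃≢d₄ (trans (sym q) s)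
  no-four-compatible (_ , _ , _ , _ , inj₂ p) (_ , _ , _ , _ , inj₁ q) (_ , _ , _ , _ , inj₂ s) _ (c₂≢c₄ , _) _ = c₂≢c₄ (trans (sym p) s)

  -- In the same reading, three arcs with at most one out and one in per index form a directed
  -- 3-cycle.
  three-compatible-cyclic : ∀ {c₁ d₁ c₂ d₂ c₃ d₃ : C} →
    Compatible c₁ d₁ c₂ d₂ → Compatible c₁ d₁ c₃ d₃ → Compatible c₂ d₂ c₃ d₃ →
    (d₂ ≡ c₁ × d₃ ≡ c₂ × d₁ ≡ c₃) ⊎ (d₁ ≡ c₂ × d₂ ≡ c₃ × d₃ ≡ c₁)
  three-compatible-cyclic (_ , _ , _ , _ , inj₁ p) (_ , _ , _ , _ , inj₁ q) (_ , d₂≢d₃ , _) = contradiction (trans (sym p) q) d₂≢d₃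
  three-compatible-cyclic (_ , _ , _ , _ , inj₂ p) (_ , _ , _ , _ , inj₂ q) (c₂≢c₃ , _) = contradiction (trans (sym p) q) c₂≢c₃
  three-compatible-cyclic (_ , _ , _ , _ , inj₁ p) (_ , _ , _ , _ , inj₂ q) (_ , _ , _ , _ , inj₁ s) = inj₁ (sym p , sym s , q)
  three-compatible-cyclic (_ , _ , _ , _ , inj₁ p) (c₁≢c₃ , _) (_ , _ , _ , _ , inj₂ s) = contradiction (trans p s) c₁≢c₃
  three-compatible-cyclic (_ , _ , _ , _ , inj₂ p) (_ , d₁≢d₃ , _) (_ , _ , _ , _ , inj₁ s) = contradiction (trans p s) d₁≢d₃
  three-compatible-cyclic (_ , _ , _ , _ , inj₂ p) (_ , _ , _ , _ , inj₁ q) (_ , _ , _ , _ , inj₂ s) = inj₂ (p , s , sym q)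

  -- K₄,₄ minus a matching: the colours of the first row determine those of the others, which meet in a rainbow 4-cycle.
  matching-clash : ∀ {c₁ c₂ c₃ c₄ a₂ a₃ a₄ b₁ b₃ b₄ e₁ e₂ e₄ : C} →
    Compatible c₂ a₂ c₃ a₃ → Compatible c₂ a₂ c₄ a₄ → Compatible c₃ a₃ c₄ a₄ →
    Compatible c₁ b₁ c₃ b₃ → Compatible c₁ b₁ c₄ b₄ → Compatible c₃ b₃ c₄ b₄ →
    Compatible c₁ e₁ c₂ e₂ → Compatible c₁ e₁ c₄ e₄ → Compatible c₂ e₂ c₄ e₄ →
    Compatible a₃ b₃ a₄ b₄ → Compatible a₂ e₂ a₄ e₄ → Compatible b₁ e₁ b₄ e₄ → ⊥
  matching-clash va₂₃ va₂₄ va₃₄ vb₁₃ vb₁₄ vb₃₄ ve₁₂ ve₁₄ ve₂₄ (_ , _ , _ , a₄≢b₄ , opposite) (_ , _ , _ , a₄≢e₄ , _) (_ , _ , _ , b₄≢e₄ , _)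
    with three-compatible-cyclic va₂₃ va₂₄ va₃₄ | three-compatible-cyclic vb₁₃ vb₁₄ vb₃₄ | three-compatible-cyclic ve₁₂ ve₁₄ ve₂₄
  -- Each lower row is a cyclic shift, in one of two directions, of the first-row colours above it.
  -- Distinctness in the fourth column rejects six of the eight choices. In the other two, rows a
  -- and b show four different colours in columns 3 and 4.
  ... | inj₁ (_ , a₄ , _) | inj₁ (_ , b₄ , _) | _ = a₄≢b₄ (trans a₄ (sym b₄))
  ... | inj₂ (_ , _ , a₄) | _ | inj₁ (_ , e₄ , _) = a₄≢e₄ (trans a₄ (sym e₄))
  ... | _ | inj₂ (_ , _ , b₄) | inj₂ (_ , _ , e₄) = b₄≢e₄ (trans b₄ (sym e₄))
  ... | inj₁ (a₃ , a₄ , _) | inj₂ (_ , b₃ , b₄) | inj₁ _ with opposite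
  ...   | inj₁ a₃≡b₄ = proj₁ ve₁₂ (trans (sym b₄) (trans (sym a₃≡b₄) a₃))
  ...   | inj₂ b₃≡a₄ = proj₁ va₃₄ (trans (sym a₄) (trans (sym b₃≡a₄) b₃))
  matching-clash va₂₃ va₂₄ va₃₄ vb₁₃ vb₁₄ vb₃₄ ve₁₂ ve₁₄ ve₂₄ (_ , _ , _ , a₄≢b₄ , opposite) (_ , _ , _ , a₄≢e₄ , _) (_ , _ , _ , b₄≢e₄ , _)
      | inj₂ (_ , a₃ , a₄) | inj₁ (b₃ , b₄ , _) | inj₂ _ with opposite
  ...   | inj₁ a₃≡b₄ = proj₁ va₃₄ (trans (sym b₄) (trans (sym a₃≡b₄) a₃))
  ...   | inj₂ b₃≡a₄ = proj₁ ve₁₂ (trans (sym b₃) (trans b₃≡a₄ a₄))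

-- Edge counts of triangle-free coloured graphs

bit : Bool → ℕ
bit true  = 1
bit false = 0

record ColouredGraph (V C : Set) : Set₁ where
  field
    adj        : V → V → Bool
    adj-sym    : ∀ a b → adj a b ≡ adj b a
    adj-irrefl : ∀ a → adj a a ≡ false
    no-triangle : ∀ {a b c} → adj a b ≡ true → adj b c ≡ true → adj a c ≡ true → ⊥
    Colour     : V → V → C → Set
    colour     : ∀ {a b} → adj a b ≡ true → ∃ (Colour a b)
    compatible : ∀ {v u y y′ c d c′ d′} → v ≢ u → y ≢ y′ →
      Colour v y c → Colour u y d → Colour v y′ c′ → Colour u y′ d′ → Compatible c d c′ d′

module _ {V C : Set} (Γ : ColouredGraph V C) where
  open ColouredGraph Γ

  degree : V → List V → ℕ
  degree a []       = 0
  degree a (y ∷ ys) = bit (adj a y) + degree a ys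

  edgeCount : List V → ℕ
  edgeCount []       = 0
  edgeCount (x ∷ xs) = degree x xs + edgeCount xs

  crossCount : List V → List V → ℕ
  crossCount []       ys = 0
  crossCount (x ∷ xs) ys = degree x ys + crossCount xs ys

  adj-sym-true : ∀ {a b} → adj a b ≡ true → adj b a ≡ true
  adj-sym-true {a} {b} e = trans (adj-sym b a) e

  degree-↭ : ∀ a {xs ys} → xs ↭ ys → degree a xs ≡ degree a ys
  degree-↭ a ↭.refl          = refl
  degree-↭ a (↭.prep x p)    = cong (bit (adj a x) +_) (degree-↭ a p)
  degree-↭ a (↭.swap {xs} {ys} x y p) = begin
    bit (adj a x) + (bit (adj a y) + degree a xs) ≡⟨ exchange (bit (adj a x)) (bit (adj a y)) (degree a xs) ⟩
    bit (adj a y) + (bit (adj a x) + degree a xs) ≡⟨ cong (λ n → bit (adj a y) + (bit (adj a x) + n)) (degree-↭ a p) ⟩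
    bit (adj a y) + (bit (adj a x) + degree a ys) ∎
    where
    open ≡-Reasoning
    exchange : ∀ m n o → m + (n + o) ≡ n + (m + o)
    exchange = solve-∀
  degree-↭ a (↭.trans p q) = trans (degree-↭ a p) (degree-↭ a q)

  edgeCount-↭ : ∀ {xs ys} → xs ↭ ys → edgeCount xs ≡ edgeCount ys
  edgeCount-↭ ↭.refl        = refl
  edgeCount-↭ (↭.prep x p)  = cong₂ _+_ (degree-↭ x p) (edgeCount-↭ p)
  edgeCount-↭ (↭.swap {xs} {ys} x y p) = trans (exchange (bit (adj x y)) (degree x xs) (degree y xs) (edgeCount xs))
    (cong₂ _+_ (cong₂ _+_ (cong bit (adj-sym x y)) (degree-↭ y p)) (cong₂ _+_ (degree-↭ x p) (edgeCount-↭ p)))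
    where
    exchange : ∀ b m n o → (b + m) + (n + o) ≡ (b + n) + (m + o)
    exchange = solve-∀
  edgeCount-↭ (↭.trans p q) = trans (edgeCount-↭ p) (edgeCount-↭ q)

  degree-++ : ∀ a xs ys → degree a (xs ++ ys) ≡ degree a xs + degree a ys
  degree-++ a []       ys = refl
  degree-++ a (x ∷ xs) ys = trans (cong (bit (adj a x) +_) (degree-++ a xs ys)) (sym (+-assoc (bit (adj a x)) _ _))

  degree-all : ∀ {a ys} → All (λ y → adj a y ≡ true) ys → degree a ys ≡ length ys
  degree-all []       = refl
  degree-all (e ∷ es) = cong₂ _+_ (cong bit e) (degree-all es)

  degree-none : ∀ {a ys} → All (λ y → adj a y ≡ false) ys → degree a ys ≡ 0
  degree-none []       = refl
  degree-none (e ∷ es) = cong₂ _+_ (cong bit e) (degree-none es)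

  crossCount-∷ʳ : ∀ xs y ys → crossCount xs (y ∷ ys) ≡ degree y xs + crossCount xs ys
  crossCount-∷ʳ []       y ys = refl
  crossCount-∷ʳ (x ∷ xs) y ys = trans (cong₂ (λ b n → (bit b + degree x ys) + n) (adj-sym x y) (crossCount-∷ʳ xs y ys))
    (exchange (bit (adj y x)) (degree x ys) (degree y xs) (crossCount xs ys))
    where
    exchange : ∀ b m n o → (b + m) + (n + o) ≡ (b + n) + (m + o)
    exchange = solve-∀

  handshake : ∀ xs → crossCount xs xs ≡ edgeCount xs + edgeCount xs
  handshake []       = refl
  handshake (x ∷ xs) = trans
    (cong₂ (λ b n → (bit b + degree x xs) + n) (adj-irrefl x) (trans (crossCount-∷ʳ xs x xs) (cong (degree x xs +_) (handshake xs))))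
    (regroup (degree x xs) (edgeCount xs))
    where
    regroup : ∀ m n → m + (m + (n + n)) ≡ (m + n) + (m + n)
    regroup = solve-∀

  highDegree : ∀ t xs ys → crossCount xs ys ≤ length xs * t ⊎ ∃ λ v → v ∈ xs × t < degree v ys
  highDegree t []       ys = inj₁ z≤n
  highDegree t (x ∷ xs) ys with degree x ys ≤? t | highDegree t xs ys
  ... | no  x≰t | _                   = inj₂ (x , here refl , ≰⇒> x≰t)
  ... | yes x≤t | inj₁ rest           = inj₁ (+-mono-≤ x≤t rest)
  ... | yes x≤t | inj₂ (v , v∈ , t<v) = inj₂ (v , there v∈ , t<v)

  neighbourSplit : ∀ v xs → ∃₂ λ U N → xs ↭ U ++ N ×
    All (λ y → adj v y ≡ false) U × All (λ y → adj v y ≡ true) N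
  neighbourSplit v []       = [] , [] , ↭-refl , [] , []
  neighbourSplit v (x ∷ xs) with U , N , p , us , ns ← neighbourSplit v xs | adj v x in eq
  ... | true  = U , x ∷ N , ↭-trans (↭.prep x p) (↭-sym (shift x U N)) , us , eq ∷ ns
  ... | false = x ∷ U , N , ↭.prep x p , eq ∷ us , ns

  K₂,₄-free : ∀ {v u ys} → v ≢ u → Unique ys → All (λ y → adj v y ≡ true) ys → All (λ y → adj u y ≡ true) ys →
    length ys ≤ 3
  K₂,₄-free {ys = []} _ _ _ _ = z≤n
  K₂,₄-free {ys = _ ∷ []} _ _ _ _ = s≤s z≤n
  K₂,₄-free {ys = _ ∷ _ ∷ []} _ _ _ _ = s≤s (s≤s z≤n)
  K₂,₄-free {ys = _ ∷ _ ∷ _ ∷ []} _ _ _ _ = s≤s (s≤s (s≤s z≤n))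
  K₂,₄-free {v} {u} {y₁ ∷ y₂ ∷ y₃ ∷ y₄ ∷ ys} v≢u
    ((y₁≢y₂ ∷ y₁≢y₃ ∷ y₁≢y₄ ∷ _) ∷ (y₂≢y₃ ∷ y₂≢y₄ ∷ _) ∷ (y₃≢y₄ ∷ _) ∷ _) (v₁ ∷ v₂ ∷ v₃ ∷ v₄ ∷ _) (u₁ ∷ u₂ ∷ u₃ ∷ u₄ ∷ _)
    with _ , c₁ ← colour v₁ | _ , c₂ ← colour v₂ | _ , c₃ ← colour v₃ | _ , c₄ ← colour v₄
       | _ , d₁ ← colour u₁ | _ , d₂ ← colour u₂ | _ , d₃ ← colour u₃ | _ , d₄ ← colour u₄ =
    ⊥-elim (no-four-compatible
      (compatible v≢u y₁≢y₂ c₁ d₁ c₂ d₂) (compatible v≢u y₁≢y₃ c₁ d₁ c₃ d₃) (compatible v≢u y₁≢y₄ c₁ d₁ c₄ d₄)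
      (compatible v≢u y₂≢y₃ c₂ d₂ c₃ d₃) (compatible v≢u y₂≢y₄ c₂ d₂ c₄ d₄) (compatible v≢u y₃≢y₄ c₃ d₃ c₄ d₄))

  degree-filter : ∀ u ys → degree u ys ≡ length (filter (λ y → adj u y 𝔹.≟ true) ys)
  degree-filter u []       = refl
  degree-filter u (y ∷ ys) with adj u y
  ... | true  = cong suc (degree-filter u ys)
  ... | false = degree-filter u ys

  degree≤3 : ∀ {v u N} → v ≢ u → Unique N → All (λ y → adj v y ≡ true) N → degree u N ≤ 3
  degree≤3 {v} {u} {N} v≢u N! vN = subst (_≤ 3) (sym (degree-filter u N))
    (K₂,₄-free v≢u (Unique.filter⁺ (λ y → adj u y 𝔹.≟ true) N!) (All.filter⁺ (λ y → adj u y 𝔹.≟ true) vN)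
      (All.all-filter (λ y → adj u y 𝔹.≟ true) N))

  neighbours-independent : ∀ {v N} → All (λ y → adj v y ≡ true) N → edgeCount N ≡ 0
  neighbours-independent [] = refl
  neighbours-independent {v} {x ∷ N} (vx ∷ vN) = cong₂ _+_ (degree-none (All.map nonadjacent vN)) (neighbours-independent vN)
    where
    nonadjacent : ∀ {y} → adj v y ≡ true → adj x y ≡ false
    nonadjacent {y} vy with adj x y in eq
    ... | false = refl
    ... | true  = ⊥-elim (no-triangle vx eq vy)

  -- Without triangles, adjacent vertices have no common neighbour.
  adjacent-degrees : ∀ {u w} → adj u w ≡ true → ∀ N → degree u N + degree w N ≤ length N
  adjacent-degrees {u} {w} uw []      = z≤n
  adjacent-degrees {u} {w} uw (y ∷ N) = subst (_≤ suc (length N)) (exchange (bit (adj u y)) (bit (adj w y)) (degree u N) (degree w N))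
    (+-mono-≤ bits (adjacent-degrees uw N))
    where
    exchange : ∀ a b m n → (a + b) + (m + n) ≡ (a + m) + (b + n)
    exchange = solve-∀
    bits : bit (adj u y) + bit (adj w y) ≤ 1
    bits with adj u y in e₁ | adj w y in e₂
    ... | false | false = z≤n
    ... | false | true  = s≤s z≤n
    ... | true  | false = s≤s z≤n
    ... | true  | true  = ⊥-elim (no-triangle uw e₂ e₁)

  some-neighbour : ∀ u N → 1 ≤ degree u N → ∃ λ i → adj u (lookup N i) ≡ true
  some-neighbour u (y ∷ N) 1≤ with adj u y in eq
  ... | true  = zero , eq
  ... | false with i , e ← some-neighbour u N 1≤ = suc i , e

  all-neighbours : ∀ u N → length N ≤ degree u N → ∀ j → adj u (lookup N j) ≡ true
  degree≤length : ∀ u N → degree u N ≤ length N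
  degree≤length u []      = z≤n
  degree≤length u (y ∷ N) = +-mono-≤ (bit≤1 (adj u y)) (degree≤length u N)
    where
    bit≤1 : ∀ b → bit b ≤ 1
    bit≤1 true  = s≤s z≤n
    bit≤1 false = z≤n
  all-neighbours u (y ∷ N) len≤ j with adj u y in eq
  ... | false = contradiction (≤-trans len≤ (degree≤length u N)) (<-irrefl refl)
  all-neighbours u (y ∷ N) len≤ zero    | true = eq
  all-neighbours u (y ∷ N) len≤ (suc j) | true = all-neighbours u N (≤-pred len≤) j

  one-nonneighbour : ∀ u y N → length N ≤ degree u (y ∷ N) → ∃ λ i → ∀ j → j ≢ i → adj u (lookup (y ∷ N) j) ≡ true
  one-nonneighbour u y N       len≤ with adj u y in eq
  one-nonneighbour u y N       len≤ | false = zero , λ { zero j≢ → contradiction refl j≢ ; (suc j) _ → all-neighbours u N len≤ j }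
  one-nonneighbour u y []      len≤ | true  = zero , λ { zero j≢ → contradiction refl j≢ }
  one-nonneighbour u y (z ∷ N) len≤ | true with i , f ← one-nonneighbour u z N (≤-pred len≤) =
    suc i , λ { zero _ → eq ; (suc j) j≢ → f j (j≢ ∘ cong suc) }

  module _ {v u₁ u₂ u₃ y₁ y₂ y₃ y₄ : V}
    (v≢u₁ : v ≢ u₁) (v≢u₂ : v ≢ u₂) (v≢u₃ : v ≢ u₃) (u₁≢u₂ : u₁ ≢ u₂) (u₁≢u₃ : u₁ ≢ u₃) (u₂≢u₃ : u₂ ≢ u₃) where

    private
      N : List V
      N = y₁ ∷ y₂ ∷ y₃ ∷ y₄ ∷ []

      y : Fin 4 → V
      y = lookup N

      missing : ∀ u → 3 ≤ degree u N → ∃ λ i → ∀ j → j ≢ i → adj u (y j) ≡ true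
      missing u = one-nonneighbour u y₁ (y₂ ∷ y₃ ∷ y₄ ∷ [])

    module _ (N! : Unique N) (vN : All (λ y → adj v y ≡ true) N) where

      private
        y-injective : ∀ {i j} → i ≢ j → y i ≢ y j
        y-injective = lookup-injective N! _ _

        v~y : ∀ j → adj v (y j) ≡ true
        v~y j = All.lookup vN (∈-lookup j)

      -- A neighbour of u₁ in N is a non-neighbour of u₂ and of u₃, hence the only one in N for
      -- each. So u₂ and u₃ share u₁ and the other three vertices of N, a K₂,₄.
      path-exclusion : All (u₁ ≢_) N → adj u₁ u₂ ≡ true → adj u₁ u₃ ≡ true →
        1 ≤ degree u₁ N → 3 ≤ degree u₂ N → 3 ≤ degree u₃ N → ⊥
      path-exclusion u₁∉N u₁₂ u₁₃ d₁ d₂ d₃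
        with i , u₁~ ← some-neighbour u₁ N d₁ | z₂ , miss₂ ← missing u₂ d₂ | z₃ , miss₃ ← missing u₃ d₃ =
        absurd
        where
        agree : ∀ {u z} → adj u₁ u ≡ true → (∀ j → j ≢ z → adj u (y j) ≡ true) → ∀ j → j ≢ i → adj u (y j) ≡ true
        agree {u} {z} u₁u miss j j≢i with i 𝔽.≟ z
        ... | yes i≡z = miss j (λ j≡z → j≢i (trans j≡z (sym i≡z)))
        ... | no  i≢z = ⊥-elim (no-triangle u₁u (miss i i≢z) u₁~)
        absurd : ⊥
        absurd with j , k , j≢k , j≢i , _ , k≢i , _ ← avoid₂ i i
          with l , l≢i , l≢j , l≢k ← avoid₃ i j k =
          <-irrefl refl (K₂,₄-free {ys = u₁ ∷ y j ∷ y k ∷ y l ∷ []} u₂≢u₃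
            ((u₁∉ j ∷ u₁∉ k ∷ u₁∉ l ∷ []) ∷ (y-injective j≢k ∷ y-injective (≢-sym l≢j) ∷ []) ∷ (y-injective (≢-sym l≢k) ∷ []) ∷ [] ∷ [])
            (adj-sym-true u₁₂ ∷ agree u₁₂ miss₂ j j≢i ∷ agree u₁₂ miss₂ k k≢i ∷ agree u₁₂ miss₂ l l≢i ∷ [])
            (adj-sym-true u₁₃ ∷ agree u₁₃ miss₃ j j≢i ∷ agree u₁₃ miss₃ k k≢i ∷ agree u₁₃ miss₃ l l≢i ∷ []))
          where
          u₁∉ : ∀ j → u₁ ≢ y j
          u₁∉ j = All.lookup u₁∉N (∈-lookup j)

      -- Each uᵢ is joined to all of N outside one vertex zᵢ. If two zᵢ coincide, two vertices of N
      -- are both joined to v, u₁, u₂, u₃, a K₂,₄. Otherwise there is a K₄,₄ minus three disjoint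
      -- edges.
      matching-exclusion : 3 ≤ degree u₁ N → 3 ≤ degree u₂ N → 3 ≤ degree u₃ N → ⊥
      matching-exclusion d₁ d₂ d₃
        with z₁ , m₁ ← missing u₁ d₁ | z₂ , m₂ ← missing u₂ d₂ | z₃ , m₃ ← missing u₃ d₃ = conclude
        where
        two-full : ∀ x x′ → (∀ j → j ≢ x → j ≢ x′ → adj u₁ (y j) ≡ true × adj u₂ (y j) ≡ true × adj u₃ (y j) ≡ true) → ⊥
        two-full x x′ full with j , k , j≢k , j≢x , j≢x′ , k≢x , k≢x′ ← avoid₂ x x′
          with j₁ , j₂ , j₃ ← full j j≢x j≢x′ | k₁ , k₂ , k₃ ← full k k≢x k≢x′ =
          <-irrefl refl (K₂,₄-free {ys = v ∷ u₁ ∷ u₂ ∷ u₃ ∷ []} (y-injective j≢k)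
            ((v≢u₁ ∷ v≢u₂ ∷ v≢u₃ ∷ []) ∷ (u₁≢u₂ ∷ u₁≢u₃ ∷ []) ∷ (u₂≢u₃ ∷ []) ∷ [] ∷ [])
            (adj-sym-true (v~y j) ∷ adj-sym-true j₁ ∷ adj-sym-true j₂ ∷ adj-sym-true j₃ ∷ [])
            (adj-sym-true (v~y k) ∷ adj-sym-true k₁ ∷ adj-sym-true k₂ ∷ adj-sym-true k₃ ∷ []))

        all-distinct : z₁ ≢ z₂ → z₁ ≢ z₃ → z₂ ≢ z₃ → ⊥
        all-distinct z₁≢z₂ z₁≢z₃ z₂≢z₃ with w , w≢z₁ , w≢z₂ , w≢z₃ ← avoid₃ z₁ z₂ z₃ =
          matching-clash
            (compatible v≢u₁ y₂₃ C₂ A₂ C₃ A₃) (compatible v≢u₁ y₂₄ C₂ A₂ C₄ A₄) (compatible v≢u₁ y₃₄ C₃ A₃ C₄ A₄)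
            (compatible v≢u₂ y₁₃ C₁ B₁ C₃ B₃) (compatible v≢u₂ y₁₄ C₁ B₁ C₄ B₄) (compatible v≢u₂ y₃₄ C₃ B₃ C₄ B₄)
            (compatible v≢u₃ y₁₂ C₁ E₁ C₂ E₂) (compatible v≢u₃ y₁₄ C₁ E₁ C₄ E₄) (compatible v≢u₃ y₂₄ C₂ E₂ C₄ E₄)
            (compatible u₁≢u₂ y₃₄ A₃ B₃ A₄ B₄) (compatible u₁≢u₃ y₂₄ A₂ E₂ A₄ E₄) (compatible u₂≢u₃ y₁₄ B₁ E₁ B₄ E₄)
          where
          y₁₂ = y-injective z₁≢z₂
          y₁₃ = y-injective z₁≢z₃
          y₂₃ = y-injective z₂≢z₃
          y₁₄ = y-injective (≢-sym w≢z₁)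
          y₂₄ = y-injective (≢-sym w≢z₂)
          y₃₄ = y-injective (≢-sym w≢z₃)
          C₁ = proj₂ (colour (v~y z₁))
          C₂ = proj₂ (colour (v~y z₂))
          C₃ = proj₂ (colour (v~y z₃))
          C₄ = proj₂ (colour (v~y w))
          A₂ = proj₂ (colour (m₁ z₂ (≢-sym z₁≢z₂)))
          A₃ = proj₂ (colour (m₁ z₃ (≢-sym z₁≢z₃)))
          A₄ = proj₂ (colour (m₁ w w≢z₁))
          B₁ = proj₂ (colour (m₂ z₁ z₁≢z₂))
          B₃ = proj₂ (colour (m₂ z₃ (≢-sym z₂≢z₃)))
          B₄ = proj₂ (colour (m₂ w w≢z₂))
          E₁ = proj₂ (colour (m₃ z₁ z₁≢z₃))
          E₂ = proj₂ (colour (m₃ z₂ z₂≢z₃))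
          E₄ = proj₂ (colour (m₃ w w≢z₃))

        conclude : ⊥
        conclude with z₁ 𝔽.≟ z₂ | z₁ 𝔽.≟ z₃ | z₂ 𝔽.≟ z₃
        ... | yes refl | _ | _ = two-full z₁ z₃ (λ j j≢z₁ j≢z₃ → m₁ j j≢z₁ , m₂ j j≢z₁ , m₃ j j≢z₃)
        ... | _ | yes refl | _ = two-full z₁ z₂ (λ j j≢z₁ j≢z₂ → m₁ j j≢z₁ , m₂ j j≢z₂ , m₃ j j≢z₁)
        ... | _ | _ | yes refl = two-full z₁ z₂ (λ j j≢z₁ j≢z₂ → m₁ j j≢z₁ , m₂ j j≢z₂ , m₃ j j≢z₂)
        ... | no z₁≢z₂ | no z₁≢z₃ | no z₂≢z₃ = all-distinct z₁≢z₂ z₁≢z₃ z₂≢z₃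

  -- The cases are the edges among u₁, u₂, u₃. With none, the degrees into N cannot all be 3; one
  -- edge bounds two of these degrees by 4 in total; a path leaves at most 6 for all three.
  rest-at-most-8 : ∀ {v u₁ u₂ u₃ y₁ y₂ y₃ y₄} → let N = y₁ ∷ y₂ ∷ y₃ ∷ y₄ ∷ [] in
    Unique (v ∷ u₁ ∷ u₂ ∷ u₃ ∷ N) → All (λ y → adj v y ≡ true) N → edgeCount (u₁ ∷ u₂ ∷ u₃ ∷ N) ≤ 8
  rest-at-most-8 {v} {u₁} {u₂} {u₃} {y₁} {y₂} {y₃} {y₄}
    ((v≢u₁ ∷ v≢u₂ ∷ v≢u₃ ∷ _) ∷ (u₁≢u₂ ∷ u₁≢u₃ ∷ u₁∉N) ∷ (u₂≢u₃ ∷ u₂∉N) ∷ u₃∉N ∷ N!) vN =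
    subst (_≤ 8) (sym (trans (cong (λ n → degree u₁ (u₂ ∷ u₃ ∷ N) + (degree u₂ (u₃ ∷ N) + (n₃ + n))) (neighbours-independent vN))
                    (regroup (bit (adj u₁ u₂)) (bit (adj u₁ u₃)) (bit (adj u₂ u₃)) n₁ n₂ n₃))) bound
    where
    N = y₁ ∷ y₂ ∷ y₃ ∷ y₄ ∷ []
    n₁ = degree u₁ N
    n₂ = degree u₂ N
    n₃ = degree u₃ N
    regroup : ∀ a b c m n o → (a + (b + m)) + ((c + n) + (o + 0)) ≡ (a + b + c) + (m + n + o)
    regroup = solve-∀
    n₁≤3 = degree≤3 v≢u₁ N! vN
    n₂≤3 = degree≤3 v≢u₂ N! vN
    n₃≤3 = degree≤3 v≢u₃ N! vN
    comm-last : ∀ m n o → m + n + o ≡ m + o + n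
    comm-last = solve-∀
    rotate : ∀ m n o → m + n + o ≡ n + o + m
    rotate = solve-∀
    centred : ∀ {a b c} → v ≢ a → v ≢ b → v ≢ c → a ≢ b → a ≢ c → b ≢ c → All (a ≢_) N →
      degree b N ≤ 3 → degree c N ≤ 3 →
      adj a b ≡ true → adj a c ≡ true → degree a N + degree b N + degree c N ≤ 6
    centred {a} {b} {c} va vb vc ab ac bc a∉N b≤3 c≤3 a~b a~c with degree c N ≤? 2 | degree b N ≤? 2 | degree a N ≤? 0
    ... | yes c≤2 | _ | _ = +-mono-≤ (adjacent-degrees a~b N) c≤2
    ... | _ | yes b≤2 | _ = subst (_≤ 6) (comm-last (degree a N) (degree c N) (degree b N)) (+-mono-≤ (adjacent-degrees a~c N) b≤2)
    ... | _ | _ | yes a≤0 = +-mono-≤ (+-mono-≤ a≤0 b≤3) c≤3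
    ... | no c≰2 | no b≰2 | no a≰0 = ⊥-elim (path-exclusion va vb vc ab ac bc N! vN a∉N a~b a~c (≰⇒> a≰0) (≰⇒> b≰2) (≰⇒> c≰2))
    bound : (bit (adj u₁ u₂) + bit (adj u₁ u₃) + bit (adj u₂ u₃)) + (n₁ + n₂ + n₃) ≤ 8
    bound with adj u₁ u₂ in e₁₂ | adj u₁ u₃ in e₁₃ | adj u₂ u₃ in e₂₃
    ... | true  | true  | true  = ⊥-elim (no-triangle e₁₂ e₂₃ e₁₃)
    ... | true  | true  | false = +-monoʳ-≤ 2 (centred v≢u₁ v≢u₂ v≢u₃ u₁≢u₂ u₁≢u₃ u₂≢u₃ u₁∉N n₂≤3 n₃≤3 e₁₂ e₁₃)
    ... | true  | false | true  = +-monoʳ-≤ 2 (subst (_≤ 6) (cong (_+ n₃) (+-comm n₂ n₁))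
      (centred v≢u₂ v≢u₁ v≢u₃ (≢-sym u₁≢u₂) u₂≢u₃ u₁≢u₃ u₂∉N n₁≤3 n₃≤3 (adj-sym-true e₁₂) e₂₃))
    ... | false | true  | true  = +-monoʳ-≤ 2 (subst (_≤ 6) (sym (trans (comm-last n₁ n₂ n₃) (cong (_+ n₂) (+-comm n₁ n₃))))
      (centred v≢u₃ v≢u₁ v≢u₂ (≢-sym u₁≢u₃) (≢-sym u₂≢u₃) u₁≢u₂ u₃∉N n₁≤3 n₂≤3 (adj-sym-true e₁₃) (adj-sym-true e₂₃)))
    ... | true  | false | false = s≤s (+-mono-≤ (adjacent-degrees e₁₂ N) n₃≤3)
    ... | false | true  | false = s≤s (subst (_≤ 7) (comm-last n₁ n₃ n₂) (+-mono-≤ (adjacent-degrees e₁₃ N) n₂≤3))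
    ... | false | false | true  = s≤s (subst (_≤ 7) (sym (rotate n₁ n₂ n₃)) (+-mono-≤ (adjacent-degrees e₂₃ N) n₁≤3))
    ... | false | false | false with n₁ ≤? 2 | n₂ ≤? 2 | n₃ ≤? 2
    ...   | yes n₁≤2 | _ | _ = +-mono-≤ (+-mono-≤ n₁≤2 n₂≤3) n₃≤3
    ...   | _ | yes n₂≤2 | _ = +-mono-≤ (+-mono-≤ n₁≤3 n₂≤2) n₃≤3
    ...   | _ | _ | yes n₃≤2 = +-mono-≤ (+-mono-≤ n₁≤3 n₂≤3) n₃≤2
    ...   | no n₁≰2 | no n₂≰2 | no n₃≰2 = ⊥-elim (matching-exclusion v≢u₁ v≢u₂ v≢u₃ u₁≢u₂ u₁≢u₃ u₂≢u₃ N! vN (≰⇒> n₁≰2) (≰⇒> n₂≰2) (≰⇒> n₃≰2))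

  rest-of-one : ∀ {v u N} → Unique (v ∷ u ∷ N) → All (λ y → adj v y ≡ true) N → edgeCount (u ∷ N) ≤ 3
  rest-of-one {v} {u} {N} ((v≢u ∷ _) ∷ _ ∷ N!) vN =
    subst (_≤ 3) (sym (trans (cong (degree u N +_) (neighbours-independent vN)) (+-identityʳ _))) (degree≤3 v≢u N! vN)

  rest-of-two : ∀ {v u₁ u₂ N} → Unique (v ∷ u₁ ∷ u₂ ∷ N) → All (λ y → adj v y ≡ true) N → length N ≤ 5 →
    edgeCount (u₁ ∷ u₂ ∷ N) ≤ 6
  rest-of-two {v} {u₁} {u₂} {N} ((v≢u₁ ∷ v≢u₂ ∷ _) ∷ _ ∷ _ ∷ N!) vN N≤5 =
    subst (_≤ 6) (sym (trans (cong (λ n → (bit (adj u₁ u₂) + degree u₁ N) + (degree u₂ N + n)) (neighbours-independent vN))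
      (regroup (bit (adj u₁ u₂)) (degree u₁ N) (degree u₂ N)))) bound
    where
    regroup : ∀ b m n → (b + m) + (n + 0) ≡ b + (m + n)
    regroup = solve-∀
    bound : bit (adj u₁ u₂) + (degree u₁ N + degree u₂ N) ≤ 6
    bound with adj u₁ u₂ in eq
    ... | true  = s≤s (≤-trans (adjacent-degrees eq N) N≤5)
    ... | false = +-mono-≤ (degree≤3 v≢u₁ N! vN) (degree≤3 v≢u₂ N! vN)

  star-edgeCount : ∀ {v U N} → All (λ y → adj v y ≡ false) U → All (λ y → adj v y ≡ true) N →
    edgeCount (v ∷ U ++ N) ≡ length N + edgeCount (U ++ N)
  star-edgeCount {v} {U} {N} vU vN = cong (_+ edgeCount (U ++ N))
    (trans (degree-++ v U N) (cong₂ _+_ (degree-none vU) (degree-all vN)))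

  around : ∀ {v xs} → v ∈ xs → ∃₂ λ U N → xs ↭ v ∷ U ++ N ×
    All (λ y → adj v y ≡ false) U × All (λ y → adj v y ≡ true) N × length N ≡ degree v xs
  around {v} v∈ with as , bs , refl ← ∈-∃++ v∈
    with U , N , p , vU , vN ← neighbourSplit v (as ++ bs) =
    U , N , ↭-trans (shift v as bs) (↭.prep v p) , vU , vN , sym (begin
      degree v (as ++ v ∷ bs)              ≡⟨ degree-↭ v (↭-trans (shift v as bs) (↭.prep v p)) ⟩
      bit (adj v v) + degree v (U ++ N)    ≡⟨ cong₂ (λ b n → bit b + n) (adj-irrefl v) (degree-++ v U N) ⟩
      degree v U + degree v N              ≡⟨ cong₂ _+_ (degree-none vU) (degree-all vN) ⟩
      length N                             ∎)
    where open ≡-Reasoning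

  private
    half : ∀ {m n} → m + m ≤ suc (n + n) → m ≤ n
    half {zero}          _ = z≤n
    half {suc m} {zero}  (s≤s p) = contradiction (subst (_≤ 0) (+-suc m m) p) λ ()
    half {suc m} {suc n} (s≤s p) = s≤s (half (≤-pred (subst₂ _≤_ (+-suc m m) (cong suc (+-suc n n)) p)))

  dense-vertex : ∀ t {b xs} → length xs * t ≤ suc (b + b) → edgeCount xs ≤ b ⊎ ∃ λ v → v ∈ xs × t < degree v xs
  dense-vertex t {b} {xs} le with highDegree t xs xs
  ... | inj₂ found = inj₂ found
  ... | inj₁ low = inj₁ (half (≤-trans (subst (_≤ length xs * t) (handshake xs) low) le))

  -- This is the bound 2n - 4 after deleting v and its edges to N. For 0, 1, 2, 3 vertices in U at
  -- most 0, 3, 6, 8 edges remain; three force N to have four vertices, and the sizes exclude more.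
  rest-bound : ∀ {v} U {N} → Unique (v ∷ U ++ N) → All (λ y → adj v y ≡ true) N →
    3 ≤ length N → 4 ≤ length N ⊎ length U + length N ≤ 4 → length U + length N ≤ 7 →
    edgeCount (U ++ N) + 2 ≤ (length U + length U) + length N
  rest-bound [] {N} U! vN 3≤N _ _ rewrite neighbours-independent vN = ≤-trans (s≤s (s≤s z≤n)) 3≤N
  rest-bound (_ ∷ []) {N} U! vN 3≤N _ _ =
    ≤-trans (+-monoˡ-≤ 2 (rest-of-one U! vN)) (+-monoʳ-≤ 2 3≤N)
  rest-bound (_ ∷ _ ∷ U) U! vN 3≤N (inj₂ small) _ =
    contradiction (≤-trans (s≤s (s≤s (≤-trans 3≤N (m≤n+m _ (length U))))) small) λ { (s≤s (s≤s (s≤s (s≤s ())))) }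
  rest-bound (_ ∷ _ ∷ []) U! vN _ (inj₁ 4≤N) (s≤s (s≤s N≤5)) =
    ≤-trans (+-monoˡ-≤ 2 (rest-of-two U! vN N≤5)) (+-monoʳ-≤ 4 4≤N)
  rest-bound (_ ∷ _ ∷ _ ∷ []) {_ ∷ _ ∷ _ ∷ _ ∷ []} U! vN _ (inj₁ 4≤N) _ = +-monoˡ-≤ 2 (rest-at-most-8 U! vN)
  rest-bound (_ ∷ _ ∷ _ ∷ []) {_ ∷ _ ∷ _ ∷ _ ∷ _ ∷ _} U! vN _ _ (s≤s (s≤s (s≤s (s≤s (s≤s (s≤s (s≤s ())))))))
  rest-bound (_ ∷ _ ∷ _ ∷ []) {_ ∷ []} U! vN (s≤s ()) _ _
  rest-bound (_ ∷ _ ∷ _ ∷ []) {_ ∷ _ ∷ []} U! vN (s≤s (s≤s ())) _ _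
  rest-bound (_ ∷ _ ∷ _ ∷ []) {_ ∷ _ ∷ _ ∷ []} U! vN _ (inj₁ (s≤s (s≤s (s≤s ())))) _
  rest-bound (_ ∷ _ ∷ _ ∷ _ ∷ U) {N} U! vN _ (inj₁ 4≤N) small =
    contradiction (≤-trans (+-monoʳ-≤ 4 (≤-trans 4≤N (m≤n+m _ (length U)))) small) (<-irrefl refl)

  private
    -- If no degree exceeds t, the handshake count leaves at most b edges; the `suc` uses that twice
    -- the edge count is even. Otherwise a vertex of degree above t is deleted.
    edgeCount-bound-at : ∀ t {n b xs} → Unique xs → length xs ≡ n → n * t ≤ suc (b + b) → b + 4 ≡ n + n →
      2 ≤ t → 3 ≤ t ⊎ n ≤ 5 → n ≤ 8 → edgeCount xs + 4 ≤ n + n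
    edgeCount-bound-at t {b = b} {xs} xs! refl few b+4 2≤t large n≤8 with dense-vertex t {b} {xs} few
    ... | inj₁ E≤b = subst (edgeCount xs + 4 ≤_) b+4 (+-monoˡ-≤ 4 E≤b)
    ... | inj₂ (v , v∈ , t<deg) with U , N , p , vU , vN , ∣N∣ ← around v∈ =
      subst₂ (λ E n → E + 4 ≤ n + n) (sym (trans (edgeCount-↭ p) (star-edgeCount vU vN))) (sym (trans (↭-length p) (cong suc (length-++ U))))
        (subst₂ _≤_ (arith₁ (edgeCount (U ++ N)) (length N)) (arith₂ (length U) (length N))
          (+-monoˡ-≤ (length N + 2) (rest-bound U (Unique-resp-↭ p xs!) vN (≤-trans (s≤s 2≤t) t<N) (sizes large) (≤-pred (subst (_≤ 8) size n≤8)))))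
      where
      t<N = subst (t <_) (sym ∣N∣) t<deg
      size : length xs ≡ suc (length U + length N)
      size = trans (↭-length p) (cong suc (length-++ U))
      sizes : 3 ≤ t ⊎ length xs ≤ 5 → 4 ≤ length N ⊎ length U + length N ≤ 4
      sizes (inj₁ 3≤t) = inj₁ (≤-trans (s≤s 3≤t) t<N)
      sizes (inj₂ n≤5) = inj₂ (≤-pred (subst (_≤ 5) size n≤5))
      arith₁ : ∀ E n → (E + 2) + (n + 2) ≡ n + E + 4
      arith₁ = solve-∀
      arith₂ : ∀ u n → (u + u + n) + (n + 2) ≡ suc (u + n) + suc (u + n)
      arith₂ = solve-∀

  -- The size 6 is absent because K₃,₃, coloured by a cyclic Latin square, satisfies all the
  -- conditions of `ColouredGraph` and has 9 edges instead of 8. Parity is essential for n = 7,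
  -- where n t = 21 = 2b + 1.
  edgeCount-bound : ∀ {n xs} → n ≡ 4 ⊎ n ≡ 5 ⊎ n ≡ 7 ⊎ n ≡ 8 → Unique xs → length xs ≡ n → edgeCount xs + 4 ≤ n + n
  edgeCount-bound (inj₁ refl) xs! len =
    edgeCount-bound-at 2 {b = 4} xs! len (≤ᵇ⇒≤ _ _ tt) refl (≤ᵇ⇒≤ _ _ tt) (inj₂ (≤ᵇ⇒≤ _ _ tt)) (≤ᵇ⇒≤ _ _ tt)
  edgeCount-bound (inj₂ (inj₁ refl)) xs! len =
    edgeCount-bound-at 2 {b = 6} xs! len (≤ᵇ⇒≤ _ _ tt) refl (≤ᵇ⇒≤ _ _ tt) (inj₂ (≤ᵇ⇒≤ _ _ tt)) (≤ᵇ⇒≤ _ _ tt)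
  edgeCount-bound (inj₂ (inj₂ (inj₁ refl))) xs! len =
    edgeCount-bound-at 3 {b = 10} xs! len (≤ᵇ⇒≤ _ _ tt) refl (≤ᵇ⇒≤ _ _ tt) (inj₁ ≤-refl) (≤ᵇ⇒≤ _ _ tt)
  edgeCount-bound (inj₂ (inj₂ (inj₂ refl))) xs! len =
    edgeCount-bound-at 3 {b = 12} xs! len (≤ᵇ⇒≤ _ _ tt) refl (≤ᵇ⇒≤ _ _ tt) (inj₁ ≤-refl) (≤ᵇ⇒≤ _ _ tt)

-- Unions of lines

does-sound : ∀ {A : Set} (a? : Dec A) → does a? ≡ true → A
does-sound (yes a) _ = a

does-⇔ : ∀ {A B : Set} (a? : Dec A) (b? : Dec B) → (A → B) → (B → A) → does a? ≡ does b?
does-⇔ (yes a) b? f g = sym (dec-true b? (f a))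
does-⇔ (no ¬a) b? f g = sym (dec-false b? (¬a ∘ g))

unique-⊆-length : ∀ {A : Set} {xs zs : List A} → Unique xs → (∀ {x} → x ∈ xs → x ∈ zs) → length xs ≤ length zs
unique-⊆-length [] _ = z≤n
unique-⊆-length {xs = x ∷ xs} (x∉xs ∷ xs!) sub with as , bs , refl ← ∈-∃++ (sub (here refl)) =
  subst (suc (length xs) ≤_) (sym (trans (length-++ as) (trans (+-suc (length as) (length bs)) (cong suc (sym (length-++ as))))))
    (s≤s (unique-⊆-length xs! skip))
  where
  skip : ∀ {y} → y ∈ xs → y ∈ as ++ bs
  skip y∈ with ∈-++⁻ as (sub (there y∈))
  ... | inj₁ y∈as          = ∈-++⁺ˡ y∈as
  ... | inj₂ (there y∈bs)  = ∈-++⁺ʳ as y∈bs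
  ... | inj₂ (here refl)   = contradiction refl (All.lookup x∉xs y∈)

length-filter-complement : ∀ {A : Set} {P : Pred A 0ℓ} (P? : Decidable P) xs →
  length xs ≡ length (filter P? xs) + length (filter (¬? ∘ P?) xs)
length-filter-complement P? [] = refl
length-filter-complement P? (x ∷ xs) with P? x
... | yes _ = cong suc (length-filter-complement P? xs)
... | no  _ = trans (cong suc (length-filter-complement P? xs)) (sym (+-suc _ _))

unique-length≤∣p∣ : ∀ {n} {xs : List (Fin n)} {p : Subset n} → Unique xs → (∀ {x} → x ∈ xs → x ∈ₛ p) → length xs ≤ ∣ p ∣
unique-length≤∣p∣ [] _ = z≤n
unique-length≤∣p∣ (x∉xs ∷ xs!) sub = ≤-trans
  (s≤s (unique-length≤∣p∣ xs! (λ y∈ → x∈p∧x≢y⇒x∈p-y (sub (there y∈)) (≢-sym (All.lookup x∉xs y∈)))))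
  (x∈p⇒∣p-x∣<∣p∣ (sub (here refl)))

∣p∪q∣≤∣p∣+∣q∣ : ∀ {n} (p q : Subset n) → ∣ p ∪ q ∣ ≤ ∣ p ∣ + ∣ q ∣
∣p∪q∣≤∣p∣+∣q∣ []            []            = z≤n
∣p∪q∣≤∣p∣+∣q∣ (inside ∷ p)  (inside ∷ q)  = s≤s (≤-trans (∣p∪q∣≤∣p∣+∣q∣ p q) (+-monoʳ-≤ ∣ p ∣ (n≤1+n _)))
∣p∪q∣≤∣p∣+∣q∣ (inside ∷ p)  (outside ∷ q) = s≤s (∣p∪q∣≤∣p∣+∣q∣ p q)
∣p∪q∣≤∣p∣+∣q∣ (outside ∷ p) (inside ∷ q)  = subst (suc ∣ p ∪ q ∣ ≤_) (sym (+-suc ∣ p ∣ ∣ q ∣)) (s≤s (∣p∪q∣≤∣p∣+∣q∣ p q))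
∣p∪q∣≤∣p∣+∣q∣ (outside ∷ p) (outside ∷ q) = ∣p∪q∣≤∣p∣+∣q∣ p q

x∈⋃⁺ : ∀ {n} {x : Fin n} {p ps} → p ∈ ps → x ∈ₛ p → x ∈ₛ ⋃ ps
x∈⋃⁺ (here refl) x∈p = x∈p∪q⁺ (inj₁ x∈p)
x∈⋃⁺ (there p∈)  x∈p = x∈p∪q⁺ (inj₂ (x∈⋃⁺ p∈ x∈p))

x∈⋃⁻ : ∀ {n} {x : Fin n} ps → x ∈ₛ ⋃ ps → ∃ λ p → p ∈ ps × x ∈ₛ p
x∈⋃⁻ []       x∈ = ⊥-elim (∉⊥ x∈)
x∈⋃⁻ (p ∷ ps) x∈ with x∈p∪q⁻ p (⋃ ps) x∈
... | inj₁ x∈p = p , here refl , x∈p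
... | inj₂ x∈ps with q , q∈ , x∈q ← x∈⋃⁻ ps x∈ps = q , there q∈ , x∈q

fromList : ∀ {n} → List (Fin n) → Subset n
fromList xs = ⋃ (map ⁅_⁆ xs)

x∈fromList⁺ : ∀ {n} {x : Fin n} {xs} → x ∈ xs → x ∈ₛ fromList xs
x∈fromList⁺ {x = x} x∈ = x∈⋃⁺ (∈-map⁺ ⁅_⁆ x∈) (x∈⁅x⁆ x)

x∈fromList⁻ : ∀ {n} {x : Fin n} xs → x ∈ₛ fromList xs → x ∈ xs
x∈fromList⁻ xs x∈ with p , p∈ , x∈p ← x∈⋃⁻ (map ⁅_⁆ xs) x∈ with y , y∈ , refl ← ∈-map⁻ ⁅_⁆ p∈ with refl ← x∈⁅y⁆⇒x≡y y x∈p = y∈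

∣fromList∣≤length : ∀ {n} (xs : List (Fin n)) → ∣ fromList xs ∣ ≤ length xs
∣fromList∣≤length {n} []   = ≤-reflexive (∣⊥∣≡0 n)
∣fromList∣≤length (x ∷ xs) = ≤-trans (∣p∪q∣≤∣p∣+∣q∣ ⁅ x ⁆ (fromList xs))
  (+-mono-≤ (≤-reflexive (∣⁅x⁆∣≡1 x)) (∣fromList∣≤length xs))

∣fromList∣≡length : ∀ {n} {xs : List (Fin n)} → Unique xs → ∣ fromList xs ∣ ≡ length xs
∣fromList∣≡length {xs = xs} xs! = ≤-antisym (∣fromList∣≤length xs) (unique-length≤∣p∣ xs! x∈fromList⁺)

-- Star graphs and the size of a union

record RainbowFreeLines (L : Set) (r n : ℕ) : Set where
  field
    _≟ᴸ_ : (A B : L) → Dec (A ≡ B)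
    pt : L → Fin r → Fin n
    pt-colour : ∀ {A B i j} → pt A i ≡ pt B j → i ≡ j
    linear : ∀ {A B i j} → i ≢ j → pt A i ≡ pt B i → pt A j ≡ pt B j → A ≡ B
    no-rainbow-triangle : ∀ {A B C i j k} → i ≢ j → i ≢ k → j ≢ k →
      pt A i ≡ pt B i → pt B j ≡ pt C j → pt C k ≡ pt A k → A ≡ B
    no-rainbow-quadrilateral : ∀ {A B C D i j k l} → i ≢ j → i ≢ k → i ≢ l → j ≢ k → j ≢ l → k ≢ l →
      pt A i ≡ pt B i → pt B j ≡ pt C j → pt C k ≡ pt D k → pt D l ≡ pt A l → A ≡ B

module _ {L : Set} {r n : ℕ} (S : RainbowFreeLines L r n) where
  open RainbowFreeLines S

  lineVertices : L → List (Fin n)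
  lineVertices A = map (pt A) (allFin r)

  lineVertices-unique : ∀ A → Unique (lineVertices A)
  lineVertices-unique A = Unique.map⁺ pt-colour (Unique.allFin⁺ r)

  edge : L → Subset n
  edge A = fromList (lineVertices A)

  ∣edge∣≡r : ∀ A → ∣ edge A ∣ ≡ r
  ∣edge∣≡r A = trans (∣fromList∣≡length (lineVertices-unique A)) (trans (length-map (pt A) (allFin r)) (length-tabulate {n = r} _))

  pt∈edge : ∀ A i → pt A i ∈ₛ edge A
  pt∈edge A i = x∈fromList⁺ (∈-map⁺ (pt A) (∈-allFin i))

  pt∈edge⁻ : ∀ {A B i} → pt A i ∈ₛ edge B → pt A i ≡ pt B i
  pt∈edge⁻ {A} {B} {i} x∈ with j , _ , eq ← ∈-map⁻ (pt B) (x∈fromList⁻ (lineVertices B) x∈) with refl ← pt-colour eq = eq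

  -- A star at each vertex, with centre a chosen line through it: a vertex on m lines carries m - 1 edges.
  module Star (centre : Fin n → L) where

    Joined : L → L → Fin r → Set
    Joined A B i = A ≢ B × pt A i ≡ pt B i × (centre (pt A i) ≡ A ⊎ centre (pt A i) ≡ B)

    joined? : ∀ A B → Dec (∃ (Joined A B))
    joined? A B = 𝔽.any? λ i → ¬? (A ≟ᴸ B) ×-dec (pt A i 𝔽.≟ pt B i) ×-dec ((centre (pt A i) ≟ᴸ A) ⊎-dec (centre (pt A i) ≟ᴸ B))

    Joined-sym : ∀ {A B i} → Joined A B i → Joined B A i
    Joined-sym (A≢B , p , inj₁ c) = ≢-sym A≢B , sym p , inj₂ (trans (cong centre (sym p)) c)
    Joined-sym (A≢B , p , inj₂ c) = ≢-sym A≢B , sym p , inj₁ (trans (cong centre (sym p)) c)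

    path-centre : ∀ {A B C i} → A ≢ C → Joined A B i → Joined B C i → centre (pt A i) ≡ B
    path-centre A≢C (_ , p , inj₂ c) _ = c
    path-centre A≢C (_ , p , inj₁ c) (_ , q , inj₁ c′) = trans (cong centre p) c′
    path-centre A≢C (_ , p , inj₁ c) (_ , q , inj₂ c′) = contradiction (trans (sym c) (trans (cong centre p) c′)) A≢C

    -- Two equal colours put all three lines on one vertex. A different third colour then gives two
    -- lines with two common vertices, and an equal one a triangle inside a star.
    no-triangle : ∀ {A B C i j k} → Joined A B i → Joined B C j → Joined A C k → ⊥
    no-triangle {A} {B} {C} {i} {j} {k} ab@(A≢B , p , _) bc@(B≢C , q , _) ac@(A≢C , s , s′) with i 𝔽.≟ j | i 𝔽.≟ k | j 𝔽.≟ k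
    ... | no i≢j | yes refl | _ = B≢C (linear i≢j (trans (sym p) s) q)
    ... | no i≢j | no i≢k | yes refl = A≢B (linear i≢j p (trans s (sym q)))
    ... | no i≢j | no i≢k | no j≢k = A≢B (no-rainbow-triangle i≢j i≢k j≢k p q (sym s))
    ... | yes refl | no i≢k | _ = A≢C (linear i≢k (trans p q) s)
    ... | yes refl | yes refl | _ with path-centre A≢C ab bc | s′
    ...   | c | inj₁ c′ = A≢B (trans (sym c′) c)
    ...   | c | inj₂ c′ = B≢C (trans (sym c) c′)

    -- If i = j, then A and C meet in the vertex on B, and D closes a triangle A, C, D. It is
    -- rainbow, or two lines share two vertices, or all lies at one vertex, where the edge between D
    -- and A misses the centre B.
    corner : ∀ {A B C D i j k l} → A ≢ C → B ≢ D → Joined A B i → Joined B C j → Joined C D k → Joined D A l → i ≢ j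
    corner {A} {B} {C} {D} {i} {_} {k} {l} A≢C B≢D ab@(A≢B , p , _) bc@(B≢C , q , _) (C≢D , s , _) (D≢A , t , t′) refl
      with k 𝔽.≟ i | l 𝔽.≟ i
    ... | no k≢i | yes refl = C≢D (linear k≢i s (sym (trans t (trans p q))))
    ... | yes refl | no l≢i = D≢A (linear l≢i t (sym (trans (trans p q) s)))
    ... | no k≢i | no l≢i with k 𝔽.≟ l
    ...   | yes refl = A≢C (linear (≢-sym k≢i) (trans p q) (sym (trans s t)))
    ...   | no k≢l = A≢C (no-rainbow-triangle (≢-sym k≢i) (≢-sym l≢i) k≢l (trans p q) s t)
    corner {A} {B} {C} {D} {i} A≢C B≢D ab@(A≢B , p , _) bc@(B≢C , q , _) (C≢D , s , _) (D≢A , t , t′) refl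
        | yes refl | yes refl with path-centre A≢C ab bc | t′
    ...   | c | inj₁ c′ = B≢D (trans (trans (sym c) (cong centre (sym t))) c′)
    ...   | c | inj₂ c′ = A≢B (trans (sym c′) (trans (cong centre t) c))

    star-compatible : ∀ {A C B D i j l k} → A ≢ C → B ≢ D →
      Joined A B i → Joined C B j → Joined A D l → Joined C D k → Compatible i j l k
    star-compatible {i = i} {j} {l} {k} A≢C B≢D ab cb ad cd = i≢l , j≢k , i≢j , l≢k , opposite
      where
      ba = Joined-sym ab
      bc = Joined-sym cb
      da = Joined-sym ad
      dc = Joined-sym cd
      i≢j = corner A≢C B≢D ab bc cd da
      l≢k = corner A≢C (≢-sym B≢D) ad dc cb ba
      i≢l = corner B≢D A≢C ba ad dc cb
      j≢k = corner B≢D (≢-sym A≢C) bc cd da ab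
      opposite : i ≡ k ⊎ j ≡ l
      opposite with i 𝔽.≟ k | j 𝔽.≟ l
      ... | yes i≡k | _ = inj₁ i≡k
      ... | _ | yes j≡l = inj₂ j≡l
      ... | no i≢k | no j≢l = contradiction
        (no-rainbow-quadrilateral i≢j i≢k i≢l j≢k j≢l (≢-sym l≢k) (proj₁ (proj₂ ab)) (proj₁ (proj₂ bc)) (proj₁ (proj₂ cd)) (proj₁ (proj₂ da)))
        (proj₁ ab)

    starGraph : ColouredGraph L (Fin r)
    starGraph = record
      { adj         = λ A B → does (joined? A B)
      ; adj-sym     = λ A B → does-⇔ (joined? A B) (joined? B A) (λ (i , e) → i , Joined-sym e) (λ (i , e) → i , Joined-sym e)
      ; adj-irrefl  = λ A → dec-false (joined? A A) (λ (i , A≢A , _) → A≢A refl)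
      ; no-triangle = λ {A} {B} {C} ab bc ac → no-triangle (proj₂ (does-sound (joined? A B) ab)) (proj₂ (does-sound (joined? B C) bc)) (proj₂ (does-sound (joined? A C) ac))
      ; Colour      = Joined
      ; colour      = λ {A} {B} → does-sound (joined? A B)
      ; compatible  = star-compatible
      }

    -- Star edges oriented towards the centre.
    Arc : L → L → Set
    Arc A B = ∃ λ i → A ≢ B × pt A i ≡ pt B i × centre (pt A i) ≡ B

    arc? : ∀ A B → Dec (Arc A B)
    arc? A B = 𝔽.any? λ i → ¬? (A ≟ᴸ B) ×-dec (pt A i 𝔽.≟ pt B i) ×-dec (centre (pt A i) ≟ᴸ B)

    Arc-asym : ∀ {A B} → Arc A B → Arc B A → ⊥
    Arc-asym (i , A≢B , p , c) (j , _ , q , c′) with i 𝔽.≟ j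
    ... | yes refl = A≢B (trans (sym c′) (trans (cong centre q) c))
    ... | no i≢j   = A≢B (linear i≢j p (sym q))

    outdegree : L → List L → ℕ
    outdegree A []       = 0
    outdegree A (B ∷ Bs) = bit (does (arc? A B)) + outdegree A Bs

    indegree : L → List L → ℕ
    indegree A []       = 0
    indegree A (B ∷ Bs) = bit (does (arc? B A)) + indegree A Bs

    arcCount : List L → List L → ℕ
    arcCount []       Bs = 0
    arcCount (A ∷ As) Bs = outdegree A Bs + arcCount As Bs

    outdegree-filter : ∀ A Bs → outdegree A Bs ≡ length (filter (arc? A) Bs)
    outdegree-filter A []       = refl
    outdegree-filter A (B ∷ Bs) with arc? A B
    ... | yes _ = cong suc (outdegree-filter A Bs)
    ... | no  _ = outdegree-filter A Bs

    arcCount-∷ʳ : ∀ As B Bs → arcCount As (B ∷ Bs) ≡ indegree B As + arcCount As Bs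
    arcCount-∷ʳ []       B Bs = refl
    arcCount-∷ʳ (A ∷ As) B Bs = trans (cong (λ m → bit (does (arc? A B)) + outdegree A Bs + m) (arcCount-∷ʳ As B Bs))
      (exchange (bit (does (arc? A B))) (outdegree A Bs) (indegree B As) (arcCount As Bs))
      where
      exchange : ∀ b m o p → (b + m) + (o + p) ≡ (b + o) + (m + p)
      exchange = solve-∀

    outdegree+indegree : ∀ A Bs → outdegree A Bs + indegree A Bs ≤ degree starGraph A Bs
    outdegree+indegree A []       = z≤n
    outdegree+indegree A (B ∷ Bs) = subst (_≤ degree starGraph A (B ∷ Bs))
      (exchange (bit (does (arc? A B))) (bit (does (arc? B A))) (outdegree A Bs) (indegree A Bs))
      (+-mono-≤ bits (outdegree+indegree A Bs))
      where
      exchange : ∀ a b m o → (a + b) + (m + o) ≡ (a + m) + (b + o)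
      exchange = solve-∀
      bits : bit (does (arc? A B)) + bit (does (arc? B A)) ≤ bit (does (joined? A B))
      bits with arc? A B | arc? B A
      ... | yes a | yes b = ⊥-elim (Arc-asym a b)
      ... | no _  | no _  = z≤n
      ... | yes (i , A≢B , p , c) | no _ = ≤-reflexive (sym (cong bit (dec-true (joined? A B) (i , A≢B , p , inj₂ c))))
      ... | no _ | yes (i , B≢A , p , c) =
        ≤-reflexive (sym (cong bit (dec-true (joined? A B) (i , ≢-sym B≢A , sym p , inj₁ (trans (cong centre (sym p)) c)))))

    arcCount≤edgeCount : ∀ As → arcCount As As ≤ edgeCount starGraph As
    arcCount≤edgeCount []       = z≤n
    arcCount≤edgeCount (A ∷ As) = subst (_≤ edgeCount starGraph (A ∷ As)) (sym regrouped)
      (+-mono-≤ (outdegree+indegree A As) (arcCount≤edgeCount As))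
      where
      regrouped : arcCount (A ∷ As) (A ∷ As) ≡ (outdegree A As + indegree A As) + arcCount As As
      regrouped = trans
        (cong₂ (λ b m → (bit b + outdegree A As) + m) (dec-false (arc? A A) (λ (_ , A≢A , _) → A≢A refl)) (arcCount-∷ʳ As A As))
        (sym (+-assoc (outdegree A As) (indegree A As) (arcCount As As)))

    owned? : ∀ A → Decidable (λ i → centre (pt A i) ≡ A)
    owned? A i = centre (pt A i) ≟ᴸ A

    ownedVertices : L → List (Fin n)
    ownedVertices A = map (pt A) (filter (owned? A) (allFin r))

    module _ {As : List L} (centre-on : ∀ {A} i → A ∈ As → centre (pt A i) ∈ As × pt (centre (pt A i)) i ≡ pt A i) where

      -- Send each vertex of A with another centre to that centre. The images differ, since a line
      -- meeting A in two vertices is A itself.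
      unowned≤outdegree : ∀ {A} → A ∈ As → length (filter (¬? ∘ owned? A) (allFin r)) ≤ outdegree A As
      unowned≤outdegree {A} A∈ = subst₂ _≤_ (length-map _ unowned) (sym (outdegree-filter A As))
        (unique-⊆-length (images-unique unowned (All.all-filter (¬? ∘ owned? A) (allFin r)) (Unique.filter⁺ (¬? ∘ owned? A) (Unique.allFin⁺ r))) inside-filter)
        where
        unowned = filter (¬? ∘ owned? A) (allFin r)
        image = λ i → centre (pt A i)
        images-unique : ∀ is → All (λ i → image i ≢ A) is → Unique is → Unique (map image is)
        images-unique []       _              _            = []
        images-unique (i ∷ is) (i-un ∷ is-un) (i∉ ∷ is!) =
          All.map⁺ (All.map (λ {j} i≢j same → i-un (sym (linear i≢j (sym (proj₂ (centre-on i A∈)))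
            (sym (trans (cong (λ B → pt B j) same) (proj₂ (centre-on j A∈))))))) i∉)
          ∷ images-unique is is-un is!
        inside-filter : ∀ {B} → B ∈ map image unowned → B ∈ filter (arc? A) As
        inside-filter B∈ with i , i∈ , refl ← ∈-map⁻ image B∈ =
          ∈-filter⁺ (arc? A) (proj₁ (centre-on i A∈))
            (i , ≢-sym (proj₂ (∈-filter⁻ (¬? ∘ owned? A) {xs = allFin r} i∈)) , sym (proj₂ (centre-on i A∈)) , refl)

      owned-total : ∀ Bs → (∀ {B} → B ∈ Bs → B ∈ As) → length Bs * r ≤ length (concat (map ownedVertices Bs)) + arcCount Bs As
      owned-total []       _   = z≤n
      owned-total (B ∷ Bs) sub = subst₂ _≤_ (cong (_+ length Bs * r) (length-tabulate {n = r} _))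
        (trans (exchange (length (ownedVertices B)) (outdegree B As) (length (concat (map ownedVertices Bs))) (arcCount Bs As))
                 (cong (_+ (outdegree B As + arcCount Bs As)) (sym (length-++ (ownedVertices B)))))
        (+-mono-≤ (≤-trans (≤-reflexive (length-filter-complement (owned? B) (allFin r)))
                    (+-mono-≤ (≤-reflexive (sym (length-map (pt B) (filter (owned? B) (allFin r))))) (unowned≤outdegree (sub (here refl)))))
                  (owned-total Bs (sub ∘ there)))
        where
        exchange : ∀ a b c d → (a + b) + (c + d) ≡ (a + c) + (b + d)
        exchange = solve-∀

      owned-unique : Unique As → Unique (concat (map ownedVertices As))
      owned-unique As! = Unique.concat⁺
        (All.map⁺ (All.universal (λ A → Unique.map⁺ pt-colour (Unique.filter⁺ (owned? A) (Unique.allFin⁺ r))) As))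
        (AllPairs.map⁺ (AllPairs.map (λ {A} {B} A≢B {_} (x∈A , x∈B) → A≢B (trans (sym (owner A x∈A)) (owner B x∈B))) As!))
        where
        owner : ∀ A {x} → x ∈ ownedVertices A → centre x ≡ A
        owner A x∈ with i , i∈ , refl ← ∈-map⁻ (pt A) x∈ = proj₂ (∈-filter⁻ (owned? A) {xs = allFin r} i∈)

      owned⊆⋃ : ∀ Bs {x} → x ∈ concat (map ownedVertices Bs) → x ∈ₛ ⋃ (map edge Bs)
      owned⊆⋃ (B ∷ Bs) x∈ with ∈-++⁻ (ownedVertices B) x∈
      ... | inj₂ x∈Bs = x∈p∪q⁺ (inj₂ (owned⊆⋃ Bs x∈Bs))
      ... | inj₁ x∈B with i , _ , refl ← ∈-map⁻ (pt B) x∈B = x∈p∪q⁺ (inj₁ (pt∈edge B i))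

      -- Owned incidences belong to different vertices of the union, and each unowned incidence
      -- accounts for an arc of its own.
      union-lower-bound : Unique As → length As * r ≤ ∣ ⋃ (map edge As) ∣ + edgeCount starGraph As
      union-lower-bound As! = ≤-trans (owned-total As (λ B∈ → B∈))
        (+-mono-≤ (unique-length≤∣p∣ (owned-unique As!) (owned⊆⋃ As)) (arcCount≤edgeCount As))

  -- The line d is a default for vertices off all listed lines; these never enter the count.
  firstOn : L → List L → Fin n → L
  firstOn d []       x = d
  firstOn d (A ∷ As) x with 𝔽.any? (λ i → pt A i 𝔽.≟ x)
  ... | yes _ = A
  ... | no  _ = firstOn d As x

  firstOn-spec : ∀ d As {A} i → A ∈ As → firstOn d As (pt A i) ∈ As × pt (firstOn d As (pt A i)) i ≡ pt A i
  firstOn-spec d (B ∷ As) {A} i A∈ with 𝔽.any? (λ j → pt B j 𝔽.≟ pt A i) | A∈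
  ... | yes (j , eq) | _ with refl ← pt-colour eq = here refl , eq
  firstOn-spec d (B ∷ As) {A} i A∈ | no ¬on | here refl = contradiction (i , refl) ¬on
  firstOn-spec d (B ∷ As) {A} i A∈ | no ¬on | there A∈As with c∈ , eq ← firstOn-spec d As i A∈As = there c∈ , eq

  span-bound : ∀ {e As} → e ≡ 4 ⊎ e ≡ 5 ⊎ e ≡ 7 ⊎ e ≡ 8 → 2 ≤ r → Unique As → length As ≡ e →
    suc (e * (r ∸ 2) + 3) ≤ ∣ ⋃ (map edge As) ∣
  span-bound {As = []} (inj₁ refl) _ _ ()
  span-bound {As = []} (inj₂ (inj₁ refl)) _ _ ()
  span-bound {As = []} (inj₂ (inj₂ (inj₁ refl))) _ _ ()
  span-bound {As = []} (inj₂ (inj₂ (inj₂ refl))) _ _ ()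
  span-bound {e} {As@(A ∷ _)} sizes 2≤r As! refl =
    +-cancelʳ-≤ E (suc (e * (r ∸ 2) + 3)) ∣ ⋃ (map edge As) ∣ (begin
      suc (e * (r ∸ 2) + 3) + E     ≡⟨ rearrange (e * (r ∸ 2)) E ⟩
      e * (r ∸ 2) + (E + 4)         ≤⟨ +-monoʳ-≤ (e * (r ∸ 2)) (edgeCount-bound starGraph sizes As! refl) ⟩
      e * (r ∸ 2) + (e + e)         ≡⟨ product e (r ∸ 2) ⟩
      e * (2 + (r ∸ 2))             ≡⟨ cong (e *_) (m+[n∸m]≡n 2≤r) ⟩
      e * r                         ≤⟨ union-lower-bound {As} (firstOn-spec A As) As! ⟩
      ∣ ⋃ (map edge As) ∣ + E       ∎)
    where
    open Star (firstOn A As)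
    open ≤-Reasoning
    E = edgeCount starGraph As
    rearrange : ∀ m E → suc (m + 3) + E ≡ m + (E + 4)
    rearrange = solve-∀
    product : ∀ e s → e * s + (e + e) ≡ e * (2 + s)
    product = solve-∀

  edge-injective : 2 ≤ r → ∀ {A B} → edge A ≡ edge B → A ≡ B
  edge-injective (s≤s (s≤s _)) {A} {B} eq = linear {i = zero} {suc zero} (λ ()) (common zero) (common (suc zero))
    where
    common : ∀ i → pt A i ≡ pt B i
    common i = pt∈edge⁻ (subst (pt A i ∈ₛ_) eq (pt∈edge A i))

  lineHypergraph : 2 ≤ r → {As : List L} → Unique As → UniformHypergraph r n
  lineHypergraph 2≤r {As} As! = record
    { edges    = map edge As
    ; distinct = Unique.map⁺ (edge-injective 2≤r) As!
    ; uniform  = All.map⁺ (All.universal ∣edge∣≡r As)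
    }

  lineHypergraph-free : ∀ {e} (2≤r : 2 ≤ r) {As} (As! : Unique As) → e ≡ 4 ⊎ e ≡ 5 ⊎ e ≡ 7 ⊎ e ≡ 8 →
    GFree (e * (r ∸ 2) + 3) e (lineHypergraph 2≤r As!)
  lineHypergraph-free 2≤r As! sizes F F! ∣F∣≡e F⊆ = from-lines (lines F F⊆)
    where
    lines : ∀ F → All (_∈ map edge _) F → ∃ λ Bs → F ≡ map edge Bs
    lines []      []        = [] , refl
    lines (E ∷ F) (E∈ ∷ F⊆) with B , _ , refl ← ∈-map⁻ edge E∈ with Bs , refl ← lines F F⊆ = B ∷ Bs , refl
    from-lines : (∃ λ Bs → F ≡ map edge Bs) → _
    from-lines (Bs , refl) = span-bound sizes 2≤r (Unique.map⁻ F!) (trans (sym (length-map edge Bs)) ∣F∣≡e)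

-- Lines with digits in a finite range

decode : ∀ {b n k} → Fin ((b ^ n) ^ k) → Fin k → Fin n → Fin b
decode x j = finToFun (finToFun x j)

encode : ∀ {b n k} → (Fin k → Fin n → Fin b) → Fin ((b ^ n) ^ k)
encode f = funToFin (λ j → funToFin (f j))

funToFin-cong : ∀ {m n} {f g : Fin m → Fin n} → f ≗ g → funToFin f ≡ funToFin g
funToFin-cong {zero}  eq = refl
funToFin-cong {suc m} eq = cong₂ combine (eq zero) (funToFin-cong (eq ∘ suc))

finToFun-injective : ∀ {m n} (x y : Fin (n ^ m)) → finToFun {n} {m} x ≗ finToFun y → x ≡ y
finToFun-injective {m} {n} x y eq = trans (sym (𝔽.funToFin-finToFin {m} {n} x)) (trans (funToFin-cong eq) (𝔽.funToFin-finToFin {m} {n} y))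

decode-injective : ∀ {b n k} (x y : Fin ((b ^ n) ^ k)) → (∀ j c → decode {b} {n} {k} x j c ≡ decode y j c) → x ≡ y
decode-injective {b} {n} {k} x y eq = finToFun-injective {k} {b ^ n} x y λ j → finToFun-injective {n} {b} _ _ (eq j)

decode-encode : ∀ {b n k} (f : Fin k → Fin n → Fin b) j c → decode {b} {n} {k} (encode f) j c ≡ f j c
decode-encode f j c = trans (cong (λ u → finToFun u c) (𝔽.finToFun-funToFin (λ j → funToFin (f j)) j)) (𝔽.finToFun-funToFin (f j) c)

encode-injective : ∀ {b n k} (f h : Fin k → Fin n → Fin b) → encode f ≡ encode h → ∀ j c → f j c ≡ h j c
encode-injective {b} {n} {k} f h eq j c = trans (sym (decode-encode f j c)) (trans (cong (λ u → decode {b} {n} {k} u j c) eq) (decode-encode h j c))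

-- Averaging over classes

sumℕ-bound : ∀ {n b} (f : Fin n → ℕ) → (∀ i → f i ≤ b) → sumℕ f ≤ n * b
sumℕ-bound {zero}  f f≤ = z≤n
sumℕ-bound {suc n} f f≤ = +-mono-≤ (f≤ zero) (sumℕ-bound (f ∘ suc) (f≤ ∘ suc))

average≤some : ∀ {n} (h : Fin (suc n) → ℕ) → ∃ λ s → sumℕ h ≤ suc n * h s
average≤some {zero}  h = zero , ≤-refl
average≤some {suc n} h with s , rest ← average≤some (h ∘ suc) with ≤-total (h zero) (h (suc s))
... | inj₁ h₀≤hs = suc s , +-mono-≤ h₀≤hs rest
... | inj₂ hs≤h₀ = zero , +-monoʳ-≤ (h zero) (≤-trans rest (*-monoʳ-≤ (suc n) hs≤h₀))

sum-indicator : ∀ {n} (t : Fin n) → sumℕ (λ s → bit (does (t 𝔽.≟ s))) ≡ 1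
sum-indicator {suc n} zero    = cong suc (sumℕ-zero n)
sum-indicator {suc n} (suc t) = sum-indicator t

module _ {A : Set} {n : ℕ} (f : A → Fin n) where

  fibre : Fin n → List A → List A
  fibre s = filter (λ x → f x 𝔽.≟ s)

  sum-fibres : ∀ xs → sumℕ (λ s → length (fibre s xs)) ≡ length xs
  sum-fibres []       = sumℕ-zero n
  sum-fibres (x ∷ xs) = trans (sumℕ-cong step) (trans (sumℕ-+ (λ s → bit (does (f x 𝔽.≟ s))) (λ s → length (fibre s xs)))
    (cong₂ _+_ (sum-indicator (f x)) (sum-fibres xs)))
    where
    step : ∀ s → length (fibre s (x ∷ xs)) ≡ bit (does (f x 𝔽.≟ s)) + length (fibre s xs)
    step s with does (f x 𝔽.≟ s)
    ... | true  = refl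
    ... | false = refl

pigeonhole : ∀ {A : Set} {n} (f : A → Fin n) → 0 < n → ∀ xs → ∃ λ s → length xs ≤ n * length (fibre f s xs)
pigeonhole {n = suc n} f _ xs with s , le ← average≤some (λ s → length (fibre f s xs)) =
  s , subst (_≤ suc n * length (fibre f s xs)) (sum-fibres f xs) le

length-cartesianProduct : ∀ {A B : Set} (xs : List A) (ys : List B) → length (cartesianProduct xs ys) ≡ length xs * length ys
length-cartesianProduct []       ys = refl
length-cartesianProduct (x ∷ xs) ys = trans (length-++ (map (x ,_) ys))
  (cong₂ _+_ (length-map (x ,_) ys) (length-cartesianProduct xs ys))

times1-< : ∀ {n g} {f : Fin n → ℕ} → 0 < g → (∀ c → f c < g) → ∀ c → times1 f c < g
times1-< 0<g f< zero    = 0<g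
times1-< 0<g f< (suc c) = f< c

timesY-< : ∀ {n g} {f : Fin n → ℕ} → 0 < g → (∀ c → f c < g) → ∀ c → timesY f c < g
timesY-< {zero}  0<g f< c       = 0<g
timesY-< {suc n} 0<g f< zero    = f< zero
timesY-< {suc n} 0<g f< (suc c) = timesY-< 0<g (f< ∘ suc) c

times1-cong : ∀ {n} {f h : Fin n → ℕ} → f ≗ h → times1 f ≗ times1 h
times1-cong eq zero    = refl
times1-cong eq (suc c) = eq c

timesY-cong : ∀ {n} {f h : Fin n → ℕ} → f ≗ h → timesY f ≗ timesY h
timesY-cong {zero}  eq c       = refl
timesY-cong {suc n} eq zero    = eq zero
timesY-cong {suc n} eq (suc c) = timesY-cong (eq ∘ suc) c

module _ {k d g : ℕ} {G : Fin d → Fin d → ℕ} (2≤g : 2 ≤ g) where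

  private
    Ad : Line k d → Set
    Ad = Admissible g G

  -- The fourth colour of the degenerate quadrilaterals below need not be one of the r colours.
  rainbow-triangle-parallel : ∀ {p q r} {A B C : Line k d} → Ad A → Ad B → Ad C → p ≢ q → p ≢ r → q ≢ r →
    Meet p A B → Meet q B C → Meet r C A → Parallel A B
  rainbow-triangle-parallel {p} {q} {r} a b c p≢q p≢r q≢r mp mq mr =
    proj₁ (rainbow-quadrilateral-parallel 2≤g {t = r} a b c c p≢q (below p (m≤m+n p (q + r))) p≢r
      (below q (≤-trans (m≤m+n q r) (m≤n+m (q + r) p))) q≢r (≢-sym (below r (≤-trans (m≤n+m r q) (m≤n+m (q + r) p)))) mp mq Meet-refl mr)
    where
    below : ∀ x → x ≤ p + (q + r) → x ≢ suc (p + (q + r))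
    below x x≤ = <⇒≢ (s≤s x≤)

  double-meet-parallel : ∀ {p q} {A B : Line k d} → Ad A → Ad B → p ≢ q → Meet p A B → Meet q A B → Parallel A B
  double-meet-parallel {p} {q} a b p≢q mp mq =
    rainbow-triangle-parallel {r = suc (p + q)} a b a p≢q (<⇒≢ (s≤s (m≤m+n p q))) (<⇒≢ (s≤s (m≤n+m q p))) mp (Meet-sym mq) Meet-refl

-- The hypergraph of all lines with a given Gram matrix

module Construction (r k d g : ℕ) (2≤g : 2 ≤ g) where

  -- For colours below r and digits below g, the coefficients x + i² t + i y of a point stay below g
  -- + r² g + r g.
  base : ℕ
  base = suc (r * r + r) * g

  gramBase : ℕ
  gramBase = suc (k * (g * g))

  Intercept Slope LineCode : Set
  Intercept = Fin ((g ^ suc d) ^ k)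
  Slope     = Fin ((g ^ d) ^ k)
  LineCode  = Intercept × Slope

  slopeDigits : Slope → Fin k → Fin d → ℕ
  slopeDigits m j c = toℕ (decode {g} {d} {k} m j c)

  toLine : LineCode → Line k d
  toLine (x , m) = line (λ j c → toℕ (decode {g} {suc d} {k} x j c)) (slopeDigits m)

  0<g : 0 < g
  0<g = ≤-trans (s≤s z≤n) 2≤g

  point-< : ∀ L i j c → i < r → point i (toLine L) j c < base
  point-< (x , m) i j c i<r = subst (point i (toLine (x , m)) j c <_) (rearrange g r)
    (+-mono-<-≤ (𝔽.toℕ<n (decode {g} {suc d} {k} x j c))
      (+-mono-≤ (*-mono-≤ (*-mono-≤ (<⇒≤ i<r) (<⇒≤ i<r)) (<⇒≤ (times1-< 0<g digits c)))
                (*-mono-≤ (<⇒≤ i<r) (<⇒≤ (timesY-< 0<g digits c)))))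
    where
    digits : ∀ c → slopeDigits m j c < g
    digits c = 𝔽.toℕ<n (decode {g} {d} {k} m j c)
    rearrange : ∀ g r → g + (r * r * g + r * g) ≡ suc (r * r + r) * g
    rearrange = solve-∀

  key-< : ∀ m a b → gram (slopeDigits m) a b < gramBase
  key-< m a b = s≤s (sumℕ-bound _ λ j → *-mono-≤ (<⇒≤ (𝔽.toℕ<n (decode {g} {d} {k} m j b))) (<⇒≤ (𝔽.toℕ<n (decode {g} {d} {k} m j a))))

  key : Slope → Fin ((gramBase ^ d) ^ d)
  key m = encode (λ a b → fromℕ< (key-< m a b))

  module _ {n : ℕ} (fits : r * (base ^ suc d) ^ k ≤ n) where

    coordinates : LineCode → Fin r → Fin k → Fin (suc d) → Fin base
    coordinates L i j c = fromℕ< (point-< L (toℕ i) j c (𝔽.toℕ<n i))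

    vertex : LineCode → Fin r → Fin n
    vertex L i = inject≤ (combine i (encode (coordinates L i))) fits

    vertex-inj : ∀ {L L′ i i′} → vertex L i ≡ vertex L′ i′ → i ≡ i′ × (∀ j c → point (toℕ i) (toLine L) j c ≡ point (toℕ i′) (toLine L′) j c)
    vertex-inj {L} {L′} {i} {i′} eq
      with i≡i′ , codes≡ ← 𝔽.combine-injective i _ i′ _ (𝔽.inject≤-injective fits fits _ _ eq) =
      i≡i′ , λ j c → 𝔽.fromℕ<-injective _ _ (point-< L (toℕ i) j c (𝔽.toℕ<n i)) (point-< L′ (toℕ i′) j c (𝔽.toℕ<n i′))
        (encode-injective {base} {suc d} {k} (coordinates L i) (coordinates L′ i′) codes≡ j c)

    vertex-meet : ∀ {L L′ i} → vertex L i ≡ vertex L′ i → Meet (toℕ i) (toLine L) (toLine L′)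
    vertex-meet eq = meet (proj₂ (vertex-inj eq))

    parallel-meet : ∀ {i} L L′ → Parallel (toLine L) (toLine L′) → Meet i (toLine L) (toLine L′) → L ≡ L′
    parallel-meet {i} (x , m) (x′ , m′) (parallel s) (meet e) = cong₂ _,_
      (decode-injective {g} {suc d} {k} x x′ λ j c → 𝔽.toℕ-injective (+-cancelʳ-≡ _ _ _ (trans (e j c)
        (cong (λ u → toℕ (decode {g} {suc d} {k} x′ j c) + u) (sym (cong₂ (λ t y → i * i * t + i * y) (times1-cong (s j) c) (timesY-cong (s j) c)))))))
      (decode-injective {g} {d} {k} m m′ λ j c → 𝔽.toℕ-injective (s j c))

    module _ (class : Fin ((gramBase ^ d) ^ d)) where

      slopes : List Slope
      slopes = fibre key class (allFin _)

      codes : List LineCode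
      codes = cartesianProduct (allFin _) slopes

      codes-unique : Unique codes
      codes-unique = Unique.cartesianProduct⁺ (Unique.allFin⁺ _) (Unique.filter⁺ (λ m → key m 𝔽.≟ class) (Unique.allFin⁺ _))

      classGram : Fin d → Fin d → ℕ
      classGram a b = toℕ (decode {gramBase} {d} {d} class a b)

      codes-admissible : ∀ A → Admissible g classGram (toLine (lookup codes A))
      codes-admissible A = admissible (λ j c → 𝔽.toℕ<n _)
        (λ a b → trans (sym (𝔽.toℕ-fromℕ< (key-< m a b)))
          (cong toℕ (trans (sym (decode-encode (λ a b → fromℕ< (key-< m a b)) a b))
            (cong (λ s → decode {gramBase} {d} {d} s a b) key≡))))
        where
        m = proj₂ (lookup codes A)
        key≡ : key m ≡ class
        key≡ = proj₂ (∈-filter⁻ (λ m → key m 𝔽.≟ class) {xs = allFin _} (proj₂ (∈-cartesianProduct⁻ (allFin _) slopes (∈-lookup {xs = codes} A))))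

      code-injective : ∀ {A B} → lookup codes A ≡ lookup codes B → A ≡ B
      code-injective {A} {B} eq with A 𝔽.≟ B
      ... | yes A≡B = A≡B
      ... | no A≢B  = contradiction eq (lookup-injective codes-unique A B A≢B)

      -- Indexed by positions in `codes`, so that every element of the type has its slope in the
      -- chosen class.
      lines : RainbowFreeLines (Fin (length codes)) r n
      lines = record
        { _≟ᴸ_      = 𝔽._≟_
        ; pt        = λ A i → vertex (lookup codes A) i
        ; pt-colour = λ eq → proj₁ (vertex-inj eq)
        ; linear    = λ {A} {B} i≢j p q → equal (double-meet-parallel 2≤g (ad A) (ad B) (toℕ≢ i≢j) (vertex-meet p) (vertex-meet q)) p
        ; no-rainbow-triangle = λ {A} {B} {C} i≢j i≢k j≢k p q s →
            equal (rainbow-triangle-parallel 2≤g (ad A) (ad B) (ad C) (toℕ≢ i≢j) (toℕ≢ i≢k) (toℕ≢ j≢k) (vertex-meet p) (vertex-meet q) (vertex-meet s)) p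
        ; no-rainbow-quadrilateral = λ {A} {B} {C} {D} i≢j i≢k i≢l j≢k j≢l k≢l p q s t →
            equal (proj₁ (rainbow-quadrilateral-parallel 2≤g (ad A) (ad B) (ad C) (ad D) (toℕ≢ i≢j) (toℕ≢ i≢k) (toℕ≢ i≢l) (toℕ≢ j≢k) (toℕ≢ j≢l) (toℕ≢ k≢l)
              (vertex-meet p) (vertex-meet q) (vertex-meet s) (vertex-meet t))) p
        }
        where
        ad = codes-admissible
        toℕ≢ : ∀ {i j : Fin r} → i ≢ j → toℕ i ≢ toℕ j
        toℕ≢ i≢j = i≢j ∘ 𝔽.toℕ-injective
        equal : ∀ {A B i} → Parallel (toLine (lookup codes A)) (toLine (lookup codes B)) → vertex (lookup codes A) i ≡ vertex (lookup codes B) i → A ≡ B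
        equal {A} {B} s p = code-injective (parallel-meet (lookup codes A) (lookup codes B) s (vertex-meet p))

    -- Intercepts stay free and only slopes are sorted by Gram matrix, so the most popular class
    -- loses no more than a factor equal to the number of classes.
    dense-free-hypergraph : ∀ e → e ≡ 4 ⊎ e ≡ 5 ⊎ e ≡ 7 ⊎ e ≡ 8 → 2 ≤ r →
      Σ (UniformHypergraph r n) λ H → GFree (e * (r ∸ 2) + 3) e H ×
        (g ^ suc d) ^ k * (g ^ d) ^ k ≤ (gramBase ^ d) ^ d * numEdges H
    dense-free-hypergraph e sizes 2≤r
      with class , many ← pigeonhole key (m^n>0 (gramBase ^ d) {{m^n≢0 gramBase d}} d) (allFin _) =
      lineHypergraph (lines class) 2≤r everything! , lineHypergraph-free (lines class) 2≤r everything! sizes , size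
      where
      everything! = Unique.allFin⁺ (length (codes class))
      X = (g ^ suc d) ^ k
      T = (gramBase ^ d) ^ d
      edges≡ : numEdges (lineHypergraph (lines class) 2≤r everything!) ≡ X * length (slopes class)
      edges≡ = trans (length-map (edge (lines class)) (allFin _)) (trans (length-tabulate {n = length (codes class)} _)
        (trans (length-cartesianProduct (allFin X) (slopes class)) (cong (_* length (slopes class)) (length-tabulate {n = X} _))))
      exchange : ∀ x t c → x * (t * c) ≡ t * (x * c)
      exchange = solve-∀
      size : X * (g ^ d) ^ k ≤ T * numEdges (lineHypergraph (lines class) 2≤r everything!)
      size = subst (X * (g ^ d) ^ k ≤_) (trans (exchange X T (length (slopes class))) (cong (T *_) (sym edges≡)))
        (*-monoʳ-≤ X (subst (_≤ T * length (slopes class)) (length-tabulate {n = (g ^ d) ^ k} _) many))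

-- Asymptotics

^-distribʳ-* : ∀ m n o → (m * n) ^ o ≡ m ^ o * n ^ o
^-distribʳ-* m n zero    = refl
^-distribʳ-* m n (suc o) = trans (cong (m * n *_) (^-distribʳ-* m n o)) (exchange m n (m ^ o) (n ^ o))
  where
  exchange : ∀ a b c d → a * b * (c * d) ≡ a * c * (b * d)
  exchange = solve-∀

-- Catches an arbitrary n between consecutive vertex counts. Raising the target by one advances g by
-- at most one, as f grows by at least one per step.
invert-increasing : (f : ℕ → ℕ) → (∀ g → f g < f (suc g)) → ∀ g₀ t → ∃ λ g → g₀ ≤ g × f g ≤ t + f g₀ × t + f g₀ < f (suc g)
invert-increasing f f↑ g₀ zero    = g₀ , ≤-refl , ≤-refl , f↑ g₀
invert-increasing f f↑ g₀ (suc t) with g , g₀≤g , fg≤ , <fg′ ← invert-increasing f f↑ g₀ t with suc t + f g₀ <? f (suc g)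
... | yes below = g , g₀≤g , m≤n⇒m≤1+n fg≤ , below
... | no ¬below = suc g , m≤n⇒m≤1+n g₀≤g , ≮⇒≥ ¬below , ≤-<-trans <fg′ (f↑ (suc g))

module Growth (r d k C q e : ℕ) (0<r : 0 < r) where

  private
    -- There are at most c₁ g^D Gram classes, and `vertexCount (suc g)` is at most c₂ g^K for
    -- positive g; the 2 in c₂ comes from g + 1 ≤ 2g.
    D K c₁ c₂ : ℕ
    D  = 2 * (d * d)
    K  = suc d * k
    c₁ = suc k ^ (d * d)
    c₂ = r * (2 * C) ^ K

  slack : ℕ
  slack = c₁ ^ q * c₂ ^ e

  vertexCount : ℕ → ℕ
  vertexCount g = r * ((C * g) ^ suc d) ^ k

  vertexCount-increasing : 0 < k → 0 < C → ∀ g → vertexCount g < vertexCount (suc g)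
  vertexCount-increasing 0<k 0<C g = *-monoʳ-< r {{>-nonZero 0<r}}
    (^-monoˡ-< k {{>-nonZero 0<k}} (^-monoˡ-< (suc d) (*-monoʳ-< C {{>-nonZero 0<C}} (n<1+n g))))

  private
    vertexCount-suc : ∀ g → 0 < g → vertexCount (suc g) ≤ c₂ * g ^ K
    vertexCount-suc g 0<g = begin
      r * ((C * suc g) ^ suc d) ^ k  ≡⟨ cong (r *_) (^-*-assoc (C * suc g) (suc d) k) ⟩
      r * (C * suc g) ^ K            ≤⟨ *-monoʳ-≤ r (^-monoˡ-≤ K (*-monoʳ-≤ C (+-monoˡ-≤ g 0<g))) ⟩
      r * (C * (g + g)) ^ K          ≡⟨ cong (λ s → r * s ^ K) (double C g) ⟩
      r * (2 * C * g) ^ K            ≡⟨ cong (r *_) (^-distribʳ-* (2 * C) g K) ⟩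
      r * ((2 * C) ^ K * g ^ K)      ≡⟨ sym (*-assoc r ((2 * C) ^ K) (g ^ K)) ⟩
      c₂ * g ^ K                     ∎
      where
      open ≤-Reasoning
      double : ∀ C g → C * (g + g) ≡ 2 * C * g
      double = solve-∀

    gramClasses : ∀ g → 0 < g → (suc (k * (g * g)) ^ d) ^ d ≤ c₁ * g ^ D
    gramClasses g 0<g = begin
      (suc (k * (g * g)) ^ d) ^ d    ≡⟨ ^-*-assoc (suc (k * (g * g))) d d ⟩
      suc (k * (g * g)) ^ (d * d)    ≤⟨ ^-monoˡ-≤ (d * d) (+-monoˡ-≤ (k * (g * g)) (*-mono-≤ 0<g 0<g)) ⟩
      (suc k * (g * g)) ^ (d * d)    ≡⟨ ^-distribʳ-* (suc k) (g * g) (d * d) ⟩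
      c₁ * (g * g) ^ (d * d)         ≡⟨ cong (λ s → c₁ * (g * s) ^ (d * d)) (sym (*-identityʳ g)) ⟩
      c₁ * (g ^ 2) ^ (d * d)         ≡⟨ cong (c₁ *_) (^-*-assoc g 2 (d * d)) ⟩
      c₁ * g ^ D                     ∎
      where open ≤-Reasoning

  -- If E^q ≤ n^e, the q-th power of `total` bounds g^((K + d k) q) by `slack` times g^(D q + K e).
  -- The spare power of g granted by `exponents` then forces g ≤ `slack`.
  many-edges : suc (D * q + K * e) ≤ (K + d * k) * q →
    ∀ {g n E} → slack < g → n < vertexCount (suc g) →
    (g ^ suc d) ^ k * (g ^ d) ^ k ≤ (suc (k * (g * g)) ^ d) ^ d * E → n ^ e < E ^ q
  many-edges exponents {g} {n} {E} slack<g n< total with n ^ e <? E ^ q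
  ... | yes found = found
  ... | no ¬found = contradiction slack<g (≤⇒≯ (*-cancelʳ-≤ g slack (g ^ (D * q + K * e)) {{m^n≢0 g (D * q + K * e)}} (begin
    g ^ suc (D * q + K * e)                    ≤⟨ ^-monoʳ-≤ g exponents ⟩
    g ^ ((K + d * k) * q)                      ≡⟨ sym (^-*-assoc g (K + d * k) q) ⟩
    (g ^ (K + d * k)) ^ q                      ≡⟨ cong (_^ q) (^-distribˡ-+-* g K (d * k)) ⟩
    (g ^ K * g ^ (d * k)) ^ q                  ≡⟨ cong (_^ q) (cong₂ _*_ (sym (^-*-assoc g (suc d) k)) (sym (^-*-assoc g d k))) ⟩
    ((g ^ suc d) ^ k * (g ^ d) ^ k) ^ q        ≤⟨ ^-monoˡ-≤ q (≤-trans total (*-monoˡ-≤ E (gramClasses g 0<g))) ⟩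
    (c₁ * g ^ D * E) ^ q                       ≡⟨ ^-distribʳ-* (c₁ * g ^ D) E q ⟩
    (c₁ * g ^ D) ^ q * E ^ q
      ≤⟨ *-monoʳ-≤ ((c₁ * g ^ D) ^ q) (≤-trans (≮⇒≥ ¬found) (^-monoˡ-≤ e (≤-trans (<⇒≤ n<) (vertexCount-suc g 0<g)))) ⟩
    (c₁ * g ^ D) ^ q * (c₂ * g ^ K) ^ e        ≡⟨ cong₂ _*_ (^-distribʳ-* c₁ (g ^ D) q) (^-distribʳ-* c₂ (g ^ K) e) ⟩
    c₁ ^ q * (g ^ D) ^ q * (c₂ ^ e * (g ^ K) ^ e)
      ≡⟨ cong₂ (λ x y → c₁ ^ q * x * (c₂ ^ e * y)) (^-*-assoc g D q) (^-*-assoc g K e) ⟩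
    c₁ ^ q * g ^ (D * q) * (c₂ ^ e * g ^ (K * e)) ≡⟨ exchange (c₁ ^ q) (g ^ (D * q)) (c₂ ^ e) (g ^ (K * e)) ⟩
    slack * (g ^ (D * q) * g ^ (K * e))        ≡⟨ cong (slack *_) (sym (^-distribˡ-+-* g (D * q) (K * e))) ⟩
    slack * g ^ (D * q + K * e)                ∎)))
    where
    open ≤-Reasoning
    0<g : 0 < g
    0<g = ≤-trans (s≤s z≤n) slack<g
    instance
      g≢0 : NonZero g
      g≢0 = >-nonZero 0<g
    exchange : ∀ a b c f → a * b * (c * f) ≡ a * c * (b * f)
    exchange = solve-∀

-- As K + d k = 2K - k, the left-over exponent is K p - k q. With d = 2q, K is at least 2 k q, so k
-- q remains, and k = 2d² + 1 lifts it above 2d² q.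
exponents : ∀ p q d k → 0 < p → 0 < q → p < 2 * q → d ≡ 2 * q → k ≡ suc (2 * (d * d)) →
  suc (2 * (d * d) * q + suc d * k * (2 * q ∸ p)) ≤ (suc d * k + d * k) * q
exponents p q d k 0<p 0<q p<2q d≡ k≡ = +-cancelʳ-≤ (k * q) _ _ (begin
  suc (D * q + K * e) + k * q    ≡⟨ left D q (K * e) (k * q) ⟩
  K * e + (suc (D * q) + k * q)  ≤⟨ +-monoʳ-≤ (K * e) (begin
    suc (D * q) + k * q            ≤⟨ +-monoˡ-≤ (k * q) (+-monoˡ-≤ (D * q) 0<q) ⟩
    suc D * q + k * q              ≡⟨ cong (λ s → s * q + k * q) (sym k≡) ⟩
    k * q + k * q                  ≡⟨ double k q ⟩
    2 * q * k                      ≡⟨ cong (_* k) (sym d≡) ⟩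
    d * k                          ≤⟨ m≤n+m (d * k) k ⟩
    K                              ≡⟨ sym (*-identityʳ K) ⟩
    K * 1                          ≤⟨ *-monoʳ-≤ K 0<p ⟩
    K * p                          ∎) ⟩
  K * e + K * p                  ≡⟨ sym (*-distribˡ-+ K e p) ⟩
  K * (e + p)                    ≡⟨ cong (K *_) (m∸n+n≡m (<⇒≤ p<2q)) ⟩
  K * (2 * q)                    ≡⟨ right d k q ⟩
  (K + d * k) * q + k * q        ∎)
  where
  open ≤-Reasoning
  D = 2 * (d * d)
  K = suc d * k
  e = 2 * q ∸ p
  left : ∀ D q x y → suc (D * q + x) + y ≡ x + (suc (D * q) + y)
  left = solve-∀
  double : ∀ k q → k * q + k * q ≡ 2 * q * k
  double = solve-∀
  right : ∀ d k q → (suc d * k) * (2 * q) ≡ (suc d * k + d * k) * q + k * q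
  right = solve-∀

dense-free : ∀ r s p q d k → 2 ≤ r → s ≡ 4 ⊎ s ≡ 5 ⊎ s ≡ 7 ⊎ s ≡ 8 → 0 < k →
  suc (2 * (d * d) * q + suc d * k * (2 * q ∸ p)) ≤ (suc d * k + d * k) * q →
  ∃ λ N → (n : ℕ) → N ≤ n →
  Σ (UniformHypergraph r n) λ H → GFree (s * (r ∸ 2) + 3) s H × n ^ (2 * q ∸ p) < numEdges H ^ q
dense-free r s p q d k 2≤r sizes 0<k exps =
  -- The 2 serves the specialisation of Y, which needs g ≥ 2; `slack` absorbs the constants.
  vertexCount (2 + slack) , hypergraph (2 + slack) (m≤m+n 2 slack) (n≤1+n (suc slack))
  where
  open Growth r d k (suc (r * r + r)) q (2 * q ∸ p) (≤-trans (s≤s z≤n) 2≤r)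
  hypergraph : ∀ g₀ → 2 ≤ g₀ → slack < g₀ → ∀ n → vertexCount g₀ ≤ n →
    Σ (UniformHypergraph r n) λ H → GFree (s * (r ∸ 2) + 3) s H × n ^ (2 * q ∸ p) < numEdges H ^ q
  hypergraph g₀ 2≤g₀ slack<g₀ n N≤n =
    let g , g₀≤g , fits , n< = invert-increasing vertexCount (vertexCount-increasing 0<k (s≤s z≤n)) g₀ (n ∸ vertexCount g₀)
        H , free , total = Construction.dense-free-hypergraph r k d g (≤-trans 2≤g₀ g₀≤g)
                             (subst (vertexCount g ≤_) (m∸n+n≡m N≤n) fits) s sizes 2≤r
    in H , free , many-edges exps (≤-trans slack<g₀ g₀≤g) (subst (_< vertexCount (suc g)) (m∸n+n≡m N≤n) n<) total

-- The o(1) term is rendered by rationals: for every p/q between 0 and 2, more than n^(2 - p/q)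
-- edges for all large n.
theorem5 : (r e : ℕ) → 3 ≤ r → (e ≡ 4 ⊎ e ≡ 5 ⊎ e ≡ 7 ⊎ e ≡ 8) →
    (p q : ℕ) → 0 < p → 0 < q → p < 2 * q →
    ∃ λ N → (n : ℕ) → N ≤ n →
    Σ (UniformHypergraph r n) λ H →
    GFree (e * (r ∸ 2) + 3) e H × n ^ (2 * q ∸ p) < numEdges H ^ q
theorem5 r e 3≤r sizes p q 0<p 0<q p<2q =
  dense-free r e p q d (suc (2 * (d * d))) (≤-trans (n≤1+n 2) 3≤r) sizes (s≤s z≤n)
    (exponents p q d (suc (2 * (d * d))) 0<p 0<q p<2q refl refl)
  where
  d = 2 * q
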